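{- For every positive integer $s$, \[\Big(\mathcal{D}_s\big(\Psi_{2s-1}(\mathbf{x}*\mathbf{y};t)\big)\Big)\Big|_{\mathbf{y}=0}=0,\] where $\mathbf{x}=(x_1,\dots,x_s)$, $\mathbf{y}=(y_1,\dots,y_{s-1})$, $\mathbf{x}*\mathbf{y}=(x_1,y_1,x_2,y_2,\dots,x_{s-1},y_{s-1},x_s)$, and \[\mathcal{D}_s=\frac{\partial^s}{\partial x_1\cdots\partial x_s}-\prod_{i=1}^{s-1}\left(\frac{\partial}{\partial x_i}+\frac{\partial}{\partial x_{i+1}}+t\,\frac{\partial}{\partial y_i}\right).\]
   Context: Ladder diagrams: $Q^+$ is the directed graph with vertex set $\mathbb{Z}_{\ge0}^2$ and directed edges $((i,j),(i,j+1))$, $((i,j),(i+1,j))$. For a sequence $\mathbf{k}=(k_1,\dots,k_m)$ of positive integers with $n=\sum k_i$ and $n_i=k_1+\dots+k_i$ ($n_0=0$), let $T_{\mathbf{k}}=\{(n_i,n-n_i):0\le i\le m\}$ (terminal vertices) and let $\Gamma_{\mathbf{k}}$ be the induced subgraph of $Q^+$ on $\{(a,b): a\le c,\ b\le d\text{ for some }(c,d)\in T_{\mathbf{k}}\}$, with origin $(0,0)$. For a sequence $\mathbf{k}$ of nonnegative integers, $\Gamma_{\mathbf{k}}:=\Gamma_{\underline{\mathbf{k}}}$ where $\underline{\mathbf{k}}$ is obtained by deleting the zero entries (for the empty sequence, $n=0$ and $\Gamma$ is the single vertex $(0,0)$). A positive path is a shortest directed path in $\Gamma_{\mathbf{k}}$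 from the origin to a terminal vertex. A face of $\Gamma_{\mathbf{k}}$ is a subgraph containing all terminal vertices which is a union of positive paths; its dimension is the rank of its first homology as a one-dimensional CW-complex. The $f$-polynomial is $F_{\mathbf{k}}(t)=\sum_{\gamma}t^{\dim\gamma}$, the sum over all faces $\gamma$ of $\Gamma_{\mathbf{k}}$. For $m\ge1$, $\Psi_m(x_1,\dots,x_m;t)=\sum_{k_1,\dots,k_m\ge0}F_{(k_1,\dots,k_m)}(t)\frac{x_1^{k_1}\cdots x_m^{k_m}}{k_1!\cdots k_m!}$, a formal power series; an empty product of operators is the identity. -}

module Defs where

open import Data.Bool using (Bool; true; false; _∧_; _∨_; not; if_then_else_)
open import Data.Nat using (ℕ; zero; suc; _+_; _∸_; _≤ᵇ_; _≡ᵇ_)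
open import Data.Product using (_×_; _,_; proj₁; proj₂)
open import Data.List using (List; []; _∷_; map; concatMap; filterᵇ; deduplicateᵇ;
  scanl; cartesianProduct; upTo; length)
open import Data.Bool.ListAction using (all; any)
open import Data.Nat.ListAction using (sum)
open import Data.Vec using (Vec; _[_]%=_; toList)
open import Data.Fin using (Fin; inject₁) renaming (suc to fsuc)
open import Data.Integer using (ℤ; +_; 0ℤ) renaming (_+_ to _+ℤ_; _-_ to _-ℤ_; _*_ to _*ℤ_)

Vertex : Set
Vertex = ℕ × ℕ

data Step : Set where
  R U : Step

-- an edge of Q⁺ is given by its source vertex and its direction
Edge : Set
Edge = Vertex × Step

move : Vertex → Step → Vertex
move (i , j) R = (suc i , j)
move (i , j) U = (i , suc j)

origin : Vertex
origin = (0 , 0)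

eqV : Vertex → Vertex → Bool
eqV (a , b) (c , d) = (a ≡ᵇ c) ∧ (b ≡ᵇ d)

eqS : Step → Step → Bool
eqS R R = true
eqS U U = true
eqS _ _ = false

eqE : Edge → Edge → Bool
eqE (v , s) (w , t) = eqV v w ∧ eqS s t

memV : Vertex → List Vertex → Bool
memV v = any (eqV v)

memE : Edge → List Edge → Bool
memE e = any (eqE e)

strip : List ℕ → List ℕ
strip [] = []
strip (zero ∷ ks) = strip ks
strip (suc k ∷ ks) = suc k ∷ strip ks

total : List ℕ → ℕ
total k = sum (strip k)

terminals : List ℕ → List Vertex
terminals k = map (λ ni → (ni , total k ∸ ni)) (scanl _+_ 0 (strip k))

inΓ : List ℕ → Vertex → Bool
inΓ k (a , b) = any (λ t → (a ≤ᵇ proj₁ t) ∧ (b ≤ᵇ proj₂ t)) (terminals k)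

-- a directed path in Q⁺ starting at v is a word of steps
vertsFrom : Vertex → List Step → List Vertex
vertsFrom v [] = v ∷ []
vertsFrom v (s ∷ w) = v ∷ vertsFrom (move v s) w

edgesFrom : Vertex → List Step → List Edge
edgesFrom v [] = []
edgesFrom v (s ∷ w) = (v , s) ∷ edgesFrom (move v s) w

endpoint : Vertex → List Step → Vertex
endpoint v [] = v
endpoint v (s ∷ w) = endpoint (move v s) w

words : ℕ → List (List Step)
words zero = [] ∷ []
words (suc n) = concatMap (λ w → (R ∷ w) ∷ (U ∷ w) ∷ []) (words n)

-- positive paths: directed paths in Γ_k (all vertices in Γ_k, hence all
-- edges in the induced subgraph) from the origin to a terminal vertex.
-- Every directed path from the origin to a terminal vertex has length n,
-- so these are exactly the shortest ones, and they are among words n.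
isPositive : List ℕ → List Step → Bool
isPositive k w = all (inΓ k) (vertsFrom origin w) ∧ memV (endpoint origin w) (terminals k)

positivePaths : List ℕ → List (List Step)
positivePaths k = filterᵇ (isPositive k) (words (total k))

sublists : {A : Set} → List A → List (List A)
sublists [] = [] ∷ []
sublists (x ∷ xs) = let r = sublists xs in r Data.List.++ map (x ∷_) r

-- candidate vertices/edges: every vertex of Γ_k lies in [0,n]²
candVerts : List ℕ → List Vertex
candVerts k = cartesianProduct (upTo (suc (total k))) (upTo (suc (total k)))

candEdges : List ℕ → List Edge
candEdges k = cartesianProduct (candVerts k) (R ∷ U ∷ [])

-- a subgraph of Γ_k, encoded canonically by the characteristic vectors of
-- its vertex set and edge set over the candidate lists
Subgraph : Set
Subgraph = List Bool × List Bool

unionOf : List ℕ → List (List Step) → Subgraph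
unionOf k P =
  ( map (λ v → any (λ p → memV v (vertsFrom origin p)) P) (candVerts k)
  , map (λ e → any (λ p → memE e (edgesFrom origin p)) P) (candEdges k) )

coversTerminals : List ℕ → List (List Step) → Bool
coversTerminals k P = all (λ t → any (λ p → memV t (vertsFrom origin p)) P) (terminals k)

eqBs : List Bool → List Bool → Bool
eqBs [] [] = true
eqBs (true ∷ xs) (true ∷ ys) = eqBs xs ys
eqBs (false ∷ xs) (false ∷ ys) = eqBs xs ys
eqBs _ _ = false

eqSub : Subgraph → Subgraph → Bool
eqSub (a , b) (c , d) = eqBs a c ∧ eqBs b d

faces : List ℕ → List Subgraph
faces k = deduplicateᵇ eqSub
  (map (unionOf k) (filterᵇ (coversTerminals k) (sublists (positivePaths k))))

countTrue : List Bool → ℕ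
countTrue [] = 0
countTrue (true ∷ xs) = suc (countTrue xs)
countTrue (false ∷ xs) = countTrue xs

-- dimension = rank H₁ = #E − #V + #components; a face is connected (every
-- path in it starts at the origin), so this is #E − #V + 1
dim : Subgraph → ℕ
dim (vs , es) = (countTrue es + 1) ∸ countTrue vs

fcoeff : List ℕ → ℕ → ℕ
fcoeff k d = length (filterᵇ (λ g → dim g ≡ᵇ d) (faces k))

-- Formal power series in exponential normalisation with coefficients in ℤ[t]:
-- a series S in variables z (m of them) is  Σ_{k,d} S k d · t^d z^k / k!.

Series : ℕ → Set
Series m = Vec ℕ m → ℕ → ℤ

Ψ : (m : ℕ) → Series m
Ψ m k d = + fcoeff (toList k) d

-- Series in variables x = (x₁,…,x_s), y = (y₁,…,y_{s-1}), s = suc r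
Series2 : ℕ → Set
Series2 r = Vec ℕ (suc r) → Vec ℕ r → ℕ → ℤ

interleave : {r : ℕ} → Vec ℕ (suc r) → Vec ℕ r → List ℕ
interleave (a Vec.∷ Vec.[]) Vec.[] = a ∷ []
interleave (a Vec.∷ as@(_ Vec.∷ _)) (b Vec.∷ bs) = a ∷ b ∷ interleave as bs

-- Ψ_{2s-1}(x * y; t) as a series in (x, y)
-- (the coefficient of x^a y^b/(a! b!) is that of (x*y)^{a*b}/(a*b)!)
ΨΨ : (r : ℕ) → Series2 r
ΨΨ r a b d = + fcoeff (interleave a b) d

∂x : {r : ℕ} → Fin (suc r) → Series2 r → Series2 r
∂x i f a b d = f (a [ i ]%= suc) b d

∂y : {r : ℕ} → Fin r → Series2 r → Series2 r
∂y i f a b d = f a (b [ i ]%= suc) d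

tMul : {r : ℕ} → Series2 r → Series2 r
tMul f a b zero = 0ℤ
tMul f a b (suc d) = f a b d

_⊕_ : {r : ℕ} → Series2 r → Series2 r → Series2 r
(f ⊕ g) a b d = f a b d +ℤ g a b d

_⊖_ : {r : ℕ} → Series2 r → Series2 r → Series2 r
(f ⊖ g) a b d = f a b d -ℤ g a b d

compose : {A : Set} → List (A → A) → A → A
compose [] x = x
compose (g ∷ gs) x = g (compose gs x)

∂xAll : (r : ℕ) → Series2 r → Series2 r
∂xAll r = compose (map ∂x (Data.List.allFin (suc r)))

Lop : {r : ℕ} → Fin r → Series2 r → Series2 r
Lop i f = (∂x (inject₁ i) f ⊕ ∂x (fsuc i) f) ⊕ tMul (∂y i f)

𝒟 : (r : ℕ) → Series2 r → Series2 r
𝒟 r f = ∂xAll r f ⊖ compose (map Lop (Data.List.allFin r)) f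

atY0 : {r : ℕ} → Series2 r → Series (suc r)
atY0 {r} f a d = f a (Data.Vec.replicate r 0) d

{-# OPTIONS --safe #-}
module Submission where

-- Cut a face along its antidiagonals.  Being a union of positive paths means exactly that below the
-- top every vertex has an outgoing edge, that every vertex other than the origin has an incoming
-- one, and that the vertices on the top antidiagonal are the terminals.  Removing the top
-- antidiagonal therefore leaves a face whose terminals are the chosen predecessors.  When all parts
-- are positive, each interior terminal independently keeps its left edge, its lower edge, or both:
-- this moves one unit into x_{i+1}, into x_i, or into a new part y_i, and only the last choice
-- raises the dimension (by one).  These are the three summands of the i-th factor of 𝒟_s, while the
-- two extreme terminals have only one possible incoming edge.

open import Defs
open import Algebra.Properties.CommutativeSemigroup using (interchange)
open import Data.Bool using (Bool; true; false; _∧_; _∨_; if_then_else_; T; T?)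
open import Data.Bool.ListAction using (all; any)
open import Data.Bool.Properties using (T-≡; ∨-zeroʳ; ∨-identityʳ; ¬-not)
open import Data.Empty using (⊥-elim)
open import Data.Fin using (Fin) renaming (zero to fzero; suc to fsuc)
open import Data.Integer using (0ℤ) renaming (+_ to pos; _+_ to _+ℤ_; _-_ to _-ℤ_)
open import Data.Integer.Properties using (+-inverseʳ)
open import Data.List using (List; []; _∷_; _++_; map; scanl; concatMap; filterᵇ; deduplicateᵇ; cartesianProduct; length; replicate; applyUpTo; upTo; tabulate; allFin)
open import Data.List.Membership.Propositional using (_∈_; find; lose)
open import Data.List.Membership.Propositional.Properties
open import Data.List.Membership.Propositional.Properties.WithK using (unique∧set⇒bag)
open import Data.List.Properties using (map-tabulate; map-cong; map-applyUpTo; length-++; length-map; length-replicate; length-applyUpTo; ∷-injectiveˡ; ∷-injectiveʳ)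
open import Data.List.Relation.Binary.BagAndSetEquality using (∼bag⇒↭)
open import Data.List.Relation.Binary.Disjoint.Propositional using (Disjoint)
open import Data.List.Relation.Binary.Permutation.Propositional.Properties using (↭-length; filter-↭)
import Data.List.Relation.Unary.All as All
open import Data.List.Relation.Unary.All using ([]; _∷_)
open import Data.List.Relation.Unary.All.Properties using (all-filter)
open import Data.List.Relation.Unary.AllPairs using ([]; _∷_)
open import Data.List.Relation.Unary.Any using (here; there)
open import Data.List.Relation.Unary.Unique.Propositional using (Unique)
open import Data.List.Relation.Unary.Unique.Propositional.Properties using (map⁺; ++⁺; filter⁺)
open import Data.Nat using (ℕ; zero; suc; _+_; _∸_; _≡ᵇ_; _≤ᵇ_; _≤_; _<_; z≤n; s≤s; s≤s⁻¹)
open import Data.Nat.ListAction using (sum)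
open import Data.Nat.Properties
open import Data.Product using (_×_; _,_; proj₁; proj₂; ∃; uncurry)
open import Data.Sum using (_⊎_; inj₁; inj₂)
import Data.Vec as Vec
open import Data.Vec using (Vec; []; _∷_; _[_]%=_)
open import Function using (_∘_; id; Equivalence; mk⇔; _⇔_)
open import Relation.Binary.PropositionalEquality
open import Relation.Nullary using (¬_; ¬?)

-- `faces` deduplicates the unions of all sublists of positive paths, so it must first be replaced
-- by an explicit list without repetitions. `IsFace` makes this possible: its conditions relate only
-- neighbouring antidiagonals, and a subgraph satisfying them is the union of all positive paths
-- inside it, because every vertex or edge extends down to the origin and up to the top. The edges
-- determine the vertices, so a face is a list of levels. Dimension then becomes additive: a level
-- contributes its edges minus the vertices they reach, and the origin, the only vertex never
-- reached, accounts for the 1 in Euler's formula.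
--
-- The factors of 𝒟_s act one after another, while the predecessors chosen at all terminals enter
-- the next count jointly. The comparison is therefore made for an arbitrary function H of the row
-- of predecessors: treating the first interior terminal replaces H by H with a fixed prefix. Rows
-- are lists of bits, in which zero parts leave no trace.

-- Faces as stacks of levels

b2n : Bool → ℕ
b2n true = 1
b2n false = 0

-- A set of edges between two consecutive antidiagonals: entry i says whether the edges going up
-- and going right out of the i-th vertex (the one with first coordinate i) are present.
Level : Set
Level = List (Bool × Bool)

sources : Level → List Bool
sources = map (uncurry _∨_)

-- The Boolean argument is the presence of an edge entering the first target from the left.
targetsFrom : Bool → Level → List Bool
targetsFrom r [] = r ∷ []
targetsFrom r ((u , r′) ∷ e) = (r ∨ u) ∷ targetsFrom r′ e

targets : Level → List Bool
targets = targetsFrom false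

-- The number of targets reached by two edges, i.e. #edges − #targets.
excessFrom : Bool → Level → ℕ
excessFrom r [] = 0
excessFrom r ((u , r′) ∷ e) = b2n (r ∧ u) + excessFrom r′ e

excess : Level → ℕ
excess = excessFrom false

-- levels u ts lists the non-empty levels with targets u ∷ ts.
levels : Bool → List Bool → List Level
levels u [] = []
levels u (t ∷ []) = ((u , t) ∷ []) ∷ []
levels u (false ∷ ts@(_ ∷ _)) = map ((u , false) ∷_) (levels false ts)
levels u (true ∷ ts@(_ ∷ _)) =
  map ((u , false) ∷_) (levels true ts) ++
  map ((u , true) ∷_) (levels false ts) ++
  map ((u , true) ∷_) (levels true ts)

-- The levels of a face, from the top one down.
Face : Set
Face = List Level

faceExcess : Face → ℕ
faceExcess [] = 0
faceExcess (e ∷ γ) = excess e + faceExcess γ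

levelFaces : ℕ → List Bool → List Face
levelFaces zero (true ∷ []) = [] ∷ []
levelFaces zero _ = []
levelFaces (suc n) [] = []
levelFaces (suc n) (t ∷ ts) = concatMap (λ e → map (e ∷_) (levelFaces n (sources e))) (levels t ts)

Poly : Set
Poly = ℕ → ℕ

t·_ : Poly → Poly
(t· f) zero = 0
(t· f) (suc d) = f d

t^_·_ : ℕ → Poly → Poly
t^ zero · f = f
t^ suc m · f = t· (t^ m · f)

-- levelSum u ts H = Σ t^(excess e) H (sources e) over e in levels u ts.
levelSum : Bool → List Bool → (List Bool → Poly) → Poly
levelSum u [] H d = 0
levelSum u (t ∷ []) H d = H ((u ∨ t) ∷ []) d
levelSum u (false ∷ ts@(_ ∷ _)) H d = levelSum false ts (H ∘ (u ∷_)) d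
levelSum u (true ∷ ts@(_ ∷ _)) H d =
  levelSum true ts (H ∘ (u ∷_)) d
  + levelSum false ts (H ∘ (true ∷_)) d
  + (t· levelSum true ts (H ∘ (true ∷_))) d

faceCount : ℕ → List Bool → Poly
faceCount zero (true ∷ []) zero = 1
faceCount zero _ _ = 0
faceCount (suc n) [] d = 0
faceCount (suc n) (t ∷ ts) d = levelSum t ts (faceCount n) d

-- Coefficient sequences and the weighted count of stacks

module _ {A : Set} where

  -- The coefficient sequence of Σ t^(w x) over the list. For `dim` and `faces k` it is `fcoeff k`
  -- by definition.
  count : (A → ℕ) → List A → Poly
  count w xs d = length (filterᵇ (λ x → w x ≡ᵇ d) xs)

  count-++ : ∀ w xs ys d → count w (xs ++ ys) d ≡ count w xs d + count w ys d
  count-++ w [] ys d = refl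
  count-++ w (x ∷ xs) ys d with w x ≡ᵇ d
  ... | true = cong suc (count-++ w xs ys d)
  ... | false = count-++ w xs ys d

  count-suc : ∀ w xs d → count (suc ∘ w) xs d ≡ (t· count w xs) d
  count-suc w [] zero = refl
  count-suc w (x ∷ xs) zero = count-suc w xs zero
  count-suc w xs (suc d) = refl

t·-cong : ∀ {f g} → (∀ d → f d ≡ g d) → ∀ d → (t· f) d ≡ (t· g) d
t·-cong eq zero = refl
t·-cong eq (suc d) = eq d

t^-cong : ∀ m {f g} → (∀ d → f d ≡ g d) → ∀ d → (t^ m · f) d ≡ (t^ m · g) d
t^-cong zero eq = eq
t^-cong (suc m) eq = t·-cong (t^-cong m eq)

count-+ : {A : Set} → ∀ m (w : A → ℕ) xs d → count (λ x → m + w x) xs d ≡ (t^ m · count w xs) d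
count-+ zero w xs d = refl
count-+ (suc m) w xs d = trans (count-suc (λ x → m + w x) xs d) (t·-cong (count-+ m w xs) d)

count-map : {A B : Set} (w : B → ℕ) (f : A → B) → ∀ xs d → count w (map f xs) d ≡ count (w ∘ f) xs d
count-map w f [] d = refl
count-map w f (x ∷ xs) d with w (f x) ≡ᵇ d
... | true = cong suc (count-map w f xs d)
... | false = count-map w f xs d

module _ {A : Set} where

  Σ[_] : List A → (A → Poly) → Poly
  Σ[ [] ] φ d = 0
  Σ[ x ∷ xs ] φ d = φ x d + Σ[ xs ] φ d

  Σ-cong : ∀ xs {φ ψ} → (∀ x d → φ x d ≡ ψ x d) → ∀ d → Σ[ xs ] φ d ≡ Σ[ xs ] ψ d
  Σ-cong [] eq d = refl
  Σ-cong (x ∷ xs) eq d = cong₂ _+_ (eq x d) (Σ-cong xs eq d)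

  Σ-++ : ∀ xs ys φ d → Σ[ xs ++ ys ] φ d ≡ Σ[ xs ] φ d + Σ[ ys ] φ d
  Σ-++ [] ys φ d = refl
  Σ-++ (x ∷ xs) ys φ d =
    trans (cong (φ x d +_) (Σ-++ xs ys φ d)) (sym (+-assoc (φ x d) _ _))

  Σ-t· : ∀ xs φ d → Σ[ xs ] (t·_ ∘ φ) d ≡ (t· Σ[ xs ] φ) d
  Σ-t· [] φ zero = refl
  Σ-t· (x ∷ xs) φ zero = Σ-t· xs φ zero
  Σ-t· [] φ (suc d) = refl
  Σ-t· (x ∷ xs) φ (suc d) = cong (φ x d +_) (Σ-t· xs φ (suc d))

  Σ-t^ : ∀ m xs φ d → Σ[ xs ] (λ x → t^ m · φ x) d ≡ (t^ m · Σ[ xs ] φ) d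
  Σ-t^ zero xs φ d = refl
  Σ-t^ (suc m) xs φ d = trans (Σ-t· xs _ d) (t·-cong (Σ-t^ m xs φ) d)

  count-concatMap : {B : Set} (w : B → ℕ) (f : A → List B) → ∀ xs d →
    count w (concatMap f xs) d ≡ Σ[ xs ] (λ x → count w (f x)) d
  count-concatMap w f [] d = refl
  count-concatMap w f (x ∷ xs) d =
    trans (count-++ w (f x) (concatMap f xs) d) (cong (count w (f x) d +_) (count-concatMap w f xs d))

Σ-map : {A B : Set} (f : A → B) → ∀ xs φ d → Σ[ map f xs ] φ d ≡ Σ[ xs ] (φ ∘ f) d
Σ-map f [] φ d = refl
Σ-map f (x ∷ xs) φ d = cong (φ (f x) d +_) (Σ-map f xs φ d)

t^-+ : ∀ m p f d → (t^ (m + p) · f) d ≡ (t^ m · (t^ p · f)) d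
t^-+ zero p f d = refl
t^-+ (suc m) p f d = t·-cong (t^-+ m p f) d

levelTerm : Bool → (List Bool → Poly) → Level → Poly
levelTerm r H e = t^ (excessFrom r e) · H (sources e)

Σ-levels-∷ : ∀ r u r′ H es d →
  Σ[ map ((u , r′) ∷_) es ] (levelTerm r H) d
  ≡ (t^ (b2n (r ∧ u)) · Σ[ es ] (levelTerm r′ (H ∘ ((u ∨ r′) ∷_)))) d
Σ-levels-∷ r u r′ H es d =
  trans (Σ-map ((u , r′) ∷_) es (levelTerm r H) d)
  (trans (Σ-cong es (λ e → t^-+ (b2n (r ∧ u)) (excessFrom r′ e) _) d)
         (Σ-t^ (b2n (r ∧ u)) es (levelTerm r′ (H ∘ ((u ∨ r′) ∷_))) d))

t^-distrib-+ : ∀ m f g d → (t^ m · (λ x → f x + g x)) d ≡ (t^ m · f) d + (t^ m · g) d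
t^-distrib-+ zero f g d = refl
t^-distrib-+ (suc m) f g zero = refl
t^-distrib-+ (suc m) f g (suc d) = t^-distrib-+ m f g d

-- The first target is entered by `r` and `u`, both fixed, so its excess factors out. Generalising
-- over `r` is what makes the induction work: the right edge chosen at one source enters the next
-- target, and the factor t in `levelSum` is this lemma with both bits present.
Σ-levels : ∀ r u ts H d →
  Σ[ levels u ts ] (levelTerm r H) d ≡ (t^ (b2n (r ∧ u)) · levelSum u ts H) d
Σ-levels r u [] H d = sym (zero-t^ (b2n (r ∧ u)) d)
  where
  zero-t^ : ∀ m d → (t^ m · (λ _ → 0)) d ≡ 0
  zero-t^ zero d = refl
  zero-t^ (suc m) zero = refl
  zero-t^ (suc m) (suc d) = zero-t^ m d
Σ-levels r u (t ∷ []) H d =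
  trans (+-identityʳ _) (t^-+ (b2n (r ∧ u)) 0 (H ((u ∨ t) ∷ [])) d)
Σ-levels r u (false ∷ ts@(_ ∷ _)) H d =
  trans (Σ-levels-∷ r u false H (levels false ts) d)
        (t^-cong (b2n (r ∧ u)) (λ d′ → trans (Σ-levels false false ts _ d′) (rw u d′)) d)
  where
  rw : ∀ u d′ → levelSum false ts (H ∘ ((u ∨ false) ∷_)) d′ ≡ levelSum false ts (H ∘ (u ∷_)) d′
  rw true d′ = refl
  rw false d′ = refl
Σ-levels r u (true ∷ ts@(_ ∷ _)) H d =
  trans (Σ-++ (map ((u , false) ∷_) (levels true ts)) _ (levelTerm r H) d)
  (trans (cong₂ _+_ (part false true (Σ-levels false true ts _))
     (trans (Σ-++ (map ((u , true) ∷_) (levels false ts)) _ (levelTerm r H) d)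
            (cong₂ _+_ (part true false (Σ-levels true false ts _)) (part true true (Σ-levels true true ts _)))))
  (trans (sym (+-assoc ((t^ m · g false true) d) _ _))
  (trans (cong (_+ (t^ m · g true true) d) (sym (t^-distrib-+ m (g false true) (g true false) d)))
  (trans (sym (t^-distrib-+ m (λ x → g false true x + g true false x) (g true true) d))
         (t^-cong m (rw u) d)))))
  where
  m = b2n (r ∧ u)
  g : Bool → Bool → Poly
  g r′ u′ = t^ (b2n (r′ ∧ u′)) · levelSum u′ ts (H ∘ ((u ∨ r′) ∷_))
  part : ∀ r′ u′ →
    (∀ d′ → Σ[ levels u′ ts ] (levelTerm r′ (H ∘ ((u ∨ r′) ∷_))) d′ ≡ g r′ u′ d′) →
    Σ[ map ((u , r′) ∷_) (levels u′ ts) ] (levelTerm r H) d ≡ (t^ m · g r′ u′) d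
  part r′ u′ ih = trans (Σ-levels-∷ r u r′ H (levels u′ ts) d) (t^-cong m ih d)
  rw : ∀ u d′ →
    levelSum true ts (H ∘ ((u ∨ false) ∷_)) d′ + levelSum false ts (H ∘ ((u ∨ true) ∷_)) d′
      + (t· levelSum true ts (H ∘ ((u ∨ true) ∷_))) d′
    ≡ levelSum true ts (H ∘ (u ∷_)) d′ + levelSum false ts (H ∘ (true ∷_)) d′
      + (t· levelSum true ts (H ∘ (true ∷_))) d′
  rw true d′ = refl
  rw false d′ = refl

count-levelFaces : ∀ n ts d → count faceExcess (levelFaces n ts) d ≡ faceCount n ts d
count-levelFaces zero [] d = refl
count-levelFaces zero (false ∷ ts) d = refl
count-levelFaces zero (true ∷ []) zero = refl
count-levelFaces zero (true ∷ []) (suc d) = refl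
count-levelFaces zero (true ∷ t ∷ ts) d = refl
count-levelFaces (suc n) [] d = refl
count-levelFaces (suc n) (t ∷ ts) d =
  trans (count-concatMap faceExcess (λ e → map (e ∷_) (levelFaces n (sources e))) (levels t ts) d)
  (trans (Σ-cong (levels t ts) (λ e d′ →
      trans (count-map faceExcess (e ∷_) (levelFaces n (sources e)) d′)
      (trans (count-+ (excess e) faceExcess (levelFaces n (sources e)) d′)
             (t^-cong (excess e) (count-levelFaces n (sources e)) d′))) d)
   (Σ-levels false t ts (faceCount n) d))

-- The recursion in terms of the parts

-- Entry i tells whether (i , n − i) is a terminal vertex.
bits : List ℕ → List Bool
bits [] = true ∷ []
bits (zero ∷ ks) = bits ks
bits (suc k ∷ ks) = true ∷ replicate k false ++ bits ks

length-bits : ∀ k → length (bits k) ≡ suc (total k)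
length-bits [] = refl
length-bits (zero ∷ ks) = length-bits ks
length-bits (suc k ∷ ks) = cong suc (begin
  length (replicate k false ++ bits ks) ≡⟨ length-++ (replicate k false) ⟩
  length (replicate k false) + length (bits ks) ≡⟨ cong₂ _+_ (length-replicate k) (length-bits ks) ⟩
  k + suc (total ks) ≡⟨ +-suc k (total ks) ⟩
  suc (k + total ks) ∎)
  where open ≡-Reasoning

-- A level with targets `u ∷ ts` has exactly `length ts` sources, so `H` is evaluated only on lists
-- of that length.
levelSum-cong : ∀ u ts {H H′} → (∀ S d → length S ≡ length ts → H S d ≡ H′ S d) →
  ∀ d → levelSum u ts H d ≡ levelSum u ts H′ d
levelSum-cong u [] eq d = refl
levelSum-cong u (t ∷ []) eq d = eq _ d refl
levelSum-cong u (false ∷ ts@(_ ∷ _)) eq d = levelSum-cong false ts (λ S d′ p → eq _ d′ (cong suc p)) d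
levelSum-cong u (true ∷ ts@(_ ∷ _)) eq d =
  cong₂ _+_ (cong₂ _+_ (levelSum-cong true ts (λ S d′ p → eq _ d′ (cong suc p)) d)
                       (levelSum-cong false ts (λ S d′ p → eq _ d′ (cong suc p)) d))
            (t·-cong (levelSum-cong true ts (λ S d′ p → eq _ d′ (cong suc p))) d)

-- An antidiagonal of degree n has n + 1 vertices, so the row alone tells how many levels lie below
-- it. The count thus becomes a function of the row, as `H` has to be.
faceCount′ : List Bool → Poly
faceCount′ ts = faceCount (length ts ∸ 1) ts

-- bits (a₁ + 1 , … , a_s + 1) without its first entry.
tailBits : ∀ {r} → Vec ℕ (suc r) → List Bool
tailBits (a ∷ []) = replicate a false ++ true ∷ []
tailBits (a ∷ as@(_ ∷ _)) = replicate a false ++ true ∷ tailBits as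

tailBits-suc : ∀ {r} a (as : Vec ℕ r) → tailBits (suc a ∷ as) ≡ false ∷ tailBits (a ∷ as)
tailBits-suc a [] = refl
tailBits-suc a (_ ∷ _) = refl

tailBits-∷ : ∀ {r} (a : Vec ℕ (suc r)) → ∃ λ t → ∃ λ ts → tailBits a ≡ t ∷ ts
tailBits-∷ (zero ∷ []) = _ , _ , refl
tailBits-∷ (suc a ∷ []) = _ , _ , refl
tailBits-∷ (zero ∷ _ ∷ _) = _ , _ , refl
tailBits-∷ (suc a ∷ _ ∷ _) = _ , _ , refl

-- The zero exponents of y contribute no bits, and each raised exponent of x contributes a nonempty
-- block.
bits-suc : ∀ {r} (a : Vec ℕ (suc r)) →
  bits (interleave (Vec.map suc a) (Vec.replicate r 0)) ≡ true ∷ tailBits a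
bits-suc (a ∷ []) = refl
bits-suc (a ∷ as@(_ ∷ _)) = cong (λ S → true ∷ replicate a false ++ S) (bits-suc as)

-- Coefficients of the differential operators

∂xs-∷ : ∀ {r} (is : List (Fin (suc r))) (f : Series2 (suc r)) a as b bs d →
  compose (map ∂x (map fsuc is)) f (a ∷ as) (b ∷ bs) d
  ≡ compose (map ∂x is) (λ as′ bs′ → f (a ∷ as′) (b ∷ bs′)) as bs d
∂xs-∷ [] f a as b bs d = refl
∂xs-∷ (i ∷ is) f a as b bs d = ∂xs-∷ is f a (as [ i ]%= suc) b bs d

∂xAll-coeff : ∀ r (f : Series2 r) a b d → ∂xAll r f a b d ≡ f (Vec.map suc a) b d
∂xAll-coeff zero f (a ∷ []) [] d = refl
∂xAll-coeff (suc r) f (a ∷ as) (b ∷ bs) d = begin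
  compose (map ∂x (tabulate fsuc)) f (suc a ∷ as) (b ∷ bs) d
    ≡⟨ cong (λ is → compose (map ∂x is) f (suc a ∷ as) (b ∷ bs) d) (sym (map-tabulate id fsuc)) ⟩
  compose (map ∂x (map fsuc (allFin (suc r)))) f (suc a ∷ as) (b ∷ bs) d
    ≡⟨ ∂xs-∷ (allFin (suc r)) f (suc a) as b bs d ⟩
  ∂xAll r (λ as′ bs′ → f (suc a ∷ as′) (b ∷ bs′)) as bs d
    ≡⟨ ∂xAll-coeff r _ as bs d ⟩
  f (suc a ∷ Vec.map suc as) (b ∷ bs) d ∎
  where open ≡-Reasoning

-- Operators of positive index never shift the first exponents, which become parameters of a series
-- in fewer variables. The split on the degree follows `tMul`.
Lops-∷ : ∀ {r} (is : List (Fin r)) (f : Series2 (suc r)) a as b bs d →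
  compose (map Lop (map fsuc is)) f (a ∷ as) (b ∷ bs) d
  ≡ compose (map Lop is) (λ as′ bs′ → f (a ∷ as′) (b ∷ bs′)) as bs d
Lops-∷ [] f a as b bs d = refl
Lops-∷ (i ∷ is) f a as b bs zero =
  cong (_+ℤ 0ℤ) (cong₂ _+ℤ_ (Lops-∷ is f a _ b bs zero) (Lops-∷ is f a _ b bs zero))
Lops-∷ (i ∷ is) f a as b bs (suc d) =
  cong₂ _+ℤ_ (cong₂ _+ℤ_ (Lops-∷ is f a _ b bs (suc d)) (Lops-∷ is f a _ b bs (suc d)))
             (Lops-∷ is f a as b (bs [ i ]%= suc) d)

-- The block of one part in `bits`. It is empty for a zero part, so `levelSum-step` also covers a
-- part that shrinks to nothing.
part : ℕ → List Bool
part zero = []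
part (suc k) = true ∷ replicate k false

bits-∷ : ∀ k ks → bits (k ∷ ks) ≡ part k ++ bits ks
bits-∷ zero ks = refl
bits-∷ (suc k) ks = refl

-- An absent target forbids both edges into it, so below a run of absent targets there is no choice
-- and the sources are absent too.
levelSum-zeros : ∀ k {t} ts H d → let S = t ∷ ts in
  levelSum false (replicate k false ++ S) H d ≡ levelSum false S (H ∘ (replicate k false ++_)) d
levelSum-zeros zero ts H d = refl
levelSum-zeros (suc zero) ts H d = refl
levelSum-zeros (suc (suc k)) ts H d = levelSum-zeros (suc k) ts (H ∘ (false ∷_)) d

replicate-∷ʳ : ∀ k (S : List Bool) → replicate k false ++ false ∷ S ≡ false ∷ replicate k false ++ S
replicate-∷ʳ zero S = refl
replicate-∷ʳ (suc k) S = cong (false ∷_) (replicate-∷ʳ k S)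

-- The three ways of reaching an interior terminal are the three terms of Lop.
levelSum-step : ∀ a ts {t} H d → let S = t ∷ ts in
  levelSum true (replicate a false ++ true ∷ S) H d
  ≡ levelSum true S (H ∘ (part (suc a) ++_)) d
    + levelSum true (false ∷ S) (H ∘ (part a ++_)) d
    + (t· levelSum true S (H ∘ (λ X → part a ++ true ∷ X))) d
levelSum-step zero ts H d = refl
levelSum-step (suc a) ts {t} H d = trans (reassoc a)
  (trans (levelSum-zeros a (t ∷ ts) (H ∘ (true ∷_)) d)
    (cong (λ x → x + levelSum false (t ∷ ts) _ d + (t· levelSum true (t ∷ ts) _) d)
      (levelSum-cong true (t ∷ ts) (λ S d′ _ → cong (λ X → H (true ∷ X) d′) (replicate-∷ʳ a S)) d)))
  where
  reassoc : ∀ a → levelSum true (replicate (suc a) false ++ true ∷ t ∷ ts) H d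
    ≡ levelSum false (replicate a false ++ true ∷ t ∷ ts) (H ∘ (true ∷_)) d
  reassoc zero = refl
  reassoc (suc a) = refl

-- The outermost operator decides the first interior terminal; each of its three terms fixes a
-- prefix of the row of predecessors. The remaining operators see only the rest of the row, so the
-- induction hypothesis is applied with `H` precomposed with that prefix.
Lops-coeff : ∀ r (f : Series2 r) (H : List Bool → Poly) →
  (∀ a b d → f a b d ≡ pos (H (bits (interleave a b)) d)) →
  ∀ a d → compose (map Lop (allFin r)) f a (Vec.replicate r 0) d ≡ pos (levelSum true (tailBits a) H d)
Lops-coeff zero f H eq (zero ∷ []) d = eq _ _ d
Lops-coeff zero f H eq (suc a ∷ []) d =
  trans (eq _ _ d) (cong pos (sym (trans (one a) (levelSum-zeros a [] (H ∘ (true ∷_)) d))))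
  where
  one : ∀ a → levelSum true (replicate (suc a) false ++ true ∷ []) H d
    ≡ levelSum false (replicate a false ++ true ∷ []) (H ∘ (true ∷_)) d
  one zero = refl
  one (suc a) = refl
Lops-coeff (suc r) f H eq (a ∷ as@(a′ ∷ as′)) d
  -- The induction hypotheses are abstracted together with `tailBits as`, so that they speak of
  -- `t ∷ ts`, on which `levelSum` can reduce. The second one is for the tail whose first exponent
  -- is raised by the middle term of `Lop`.
  with tailBits as | tailBits-∷ as | tailBits-suc a′ as′
     | (λ H′ d′ f′ eq′ → Lops-coeff r f′ H′ eq′ as d′)
     | (λ H′ d′ f′ eq′ → Lops-coeff r f′ H′ eq′ (suc a′ ∷ as′) d′)
... | .(t ∷ ts) | t , ts , refl | sucEq | ih | ih⁺ = begin
  compose (map Lop (allFin (suc r))) f (a ∷ as) (0 ∷ z) d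
    ≡⟨ cong (λ is → Lop fzero (compose (map Lop is) f) (a ∷ as) (0 ∷ z) d) (sym (map-tabulate id fsuc)) ⟩
  Lop fzero (compose (map Lop (map fsuc (allFin r))) f) (a ∷ as) (0 ∷ z) d
    ≡⟨ cong₂ _+ℤ_ (cong₂ _+ℤ_
         (trans (Lops-∷ (allFin r) f (suc a) as 0 z d) (ih (H ∘ (part (suc a) ++_)) d _ (shift₀ (suc a))))
         (trans (Lops-∷ (allFin r) f a (suc a′ ∷ as′) 0 z d)
           (trans (ih⁺ (H ∘ (part a ++_)) d _ (shift₀ a)) (cong (λ S → pos (levelSum true S (H ∘ (part a ++_)) d)) sucEq))))
         (tTerm d) ⟩
  pos (levelSum true (t ∷ ts) (H ∘ (part (suc a) ++_)) d
    + levelSum true (false ∷ t ∷ ts) (H ∘ (part a ++_)) d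
    + (t· levelSum true (t ∷ ts) (H ∘ (λ X → part a ++ true ∷ X))) d)
    ≡⟨ cong pos (sym (levelSum-step a ts H d)) ⟩
  pos (levelSum true (replicate a false ++ true ∷ t ∷ ts) H d) ∎
  where
  open ≡-Reasoning
  z = Vec.replicate r 0
  shift₀ : ∀ x as″ bs d′ → f (x ∷ as″) (0 ∷ bs) d′ ≡ pos (H (part x ++ bits (interleave as″ bs)) d′)
  shift₀ x as″@(_ ∷ _) bs d′ = trans (eq (x ∷ as″) (0 ∷ bs) d′) (cong (λ S → pos (H S d′)) (bits-∷ x _))
  shift₁ : ∀ as″ bs d′ → f (a ∷ as″) (1 ∷ bs) d′ ≡ pos (H (part a ++ true ∷ bits (interleave as″ bs)) d′)
  shift₁ as″@(_ ∷ _) bs d′ = trans (eq (a ∷ as″) (1 ∷ bs) d′) (cong (λ S → pos (H S d′)) (bits-∷ a _))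
  tTerm : ∀ d → tMul (∂y fzero (compose (map Lop (map fsuc (allFin r))) f)) (a ∷ as) (0 ∷ z) d
    ≡ pos ((t· levelSum true (t ∷ ts) (H ∘ (λ X → part a ++ true ∷ X))) d)
  tTerm zero = refl
  tTerm (suc d) = trans (Lops-∷ (allFin r) f a as 1 z d) (ih _ d _ shift₁)

-- Unions of positive paths

∨-true : ∀ a {b} → a ∨ b ≡ true → a ≡ true ⊎ b ≡ true
∨-true true eq = inj₁ refl
∨-true false eq = inj₂ eq

∨-trueˡ : ∀ {a} b → a ≡ true → a ∨ b ≡ true
∨-trueˡ b refl = refl

∨-trueʳ : ∀ a {b} → b ≡ true → a ∨ b ≡ true
∨-trueʳ a refl = ∨-zeroʳ a

∧-true : ∀ a {b} → a ∧ b ≡ true → a ≡ true × b ≡ true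
∧-true true eq = refl , eq

bool-ext : ∀ {a b} → (a ≡ true → b ≡ true) → (b ≡ true → a ≡ true) → a ≡ b
bool-ext {true} f g = sym (f refl)
bool-ext {false} {true} f g = g refl
bool-ext {false} {false} f g = refl

module _ {A : Set} where

  any⁻ : ∀ f (xs : List A) → any f xs ≡ true → ∃ λ x → x ∈ xs × f x ≡ true
  any⁻ f (x ∷ xs) eq with ∨-true (f x) eq
  ... | inj₁ p = x , here refl , p
  ... | inj₂ q with any⁻ f xs q
  ... | y , y∈ , p = y , there y∈ , p

  any⁺ : ∀ f {xs : List A} {x} → x ∈ xs → f x ≡ true → any f xs ≡ true
  any⁺ f (here refl) p = ∨-trueˡ _ p
  any⁺ f (there {x = y} x∈) p = ∨-trueʳ (f y) (any⁺ f x∈ p)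

  all⁻ : ∀ f {xs : List A} {x} → all f xs ≡ true → x ∈ xs → f x ≡ true
  all⁻ f {y ∷ xs} eq (here refl) = proj₁ (∧-true (f y) eq)
  all⁻ f {y ∷ xs} eq (there x∈) = all⁻ f (proj₂ (∧-true (f y) eq)) x∈

  all⁺ : ∀ f (xs : List A) → (∀ x → x ∈ xs → f x ≡ true) → all f xs ≡ true
  all⁺ f [] h = refl
  all⁺ f (x ∷ xs) h = cong₂ _∧_ (h x (here refl)) (all⁺ f xs (λ y y∈ → h y (there y∈)))

  filterᵇ⁺ : ∀ (f : A → Bool) {x xs} → x ∈ xs → f x ≡ true → x ∈ filterᵇ f xs
  filterᵇ⁺ f x∈ p = ∈-filter⁺ (T? ∘ f) x∈ (Equivalence.from T-≡ p)

  filterᵇ⁻ : ∀ (f : A → Bool) {x xs} → x ∈ filterᵇ f xs → x ∈ xs × f x ≡ true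
  filterᵇ⁻ f {xs = xs} x∈ with ∈-filter⁻ (T? ∘ f) {xs = xs} x∈
  ... | p , q = p , Equivalence.to T-≡ q

  filterᵇ-sublist : ∀ (f : A → Bool) xs → filterᵇ f xs ∈ sublists xs
  filterᵇ-sublist f [] = here refl
  filterᵇ-sublist f (x ∷ xs) with f x
  ... | true = ∈-++⁺ʳ (sublists xs) (∈-map⁺ (x ∷_) (filterᵇ-sublist f xs))
  ... | false = ∈-++⁺ˡ (filterᵇ-sublist f xs)

  sublist-⊆ : ∀ (xs : List A) {ys x} → ys ∈ sublists xs → x ∈ ys → x ∈ xs
  sublist-⊆ [] (here refl) ()
  sublist-⊆ (z ∷ xs) ys∈ x∈ with ∈-++⁻ (sublists xs) ys∈
  ... | inj₁ p = there (sublist-⊆ xs p x∈)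
  ... | inj₂ q with ∈-map⁻ (z ∷_) q
  sublist-⊆ (z ∷ xs) ys∈ (here refl) | inj₂ q | zs , p , refl = here refl
  sublist-⊆ (z ∷ xs) ys∈ (there x∈) | inj₂ q | zs , p , refl = there (sublist-⊆ xs p x∈)

≡ᵇ-sound : ∀ m n → (m ≡ᵇ n) ≡ true → m ≡ n
≡ᵇ-sound m n eq = ≡ᵇ⇒≡ m n (Equivalence.from T-≡ eq)

≡ᵇ-refl : ∀ n → (n ≡ᵇ n) ≡ true
≡ᵇ-refl n = Equivalence.to T-≡ (≡⇒≡ᵇ n n refl)

eqV-sound : ∀ v w → eqV v w ≡ true → v ≡ w
eqV-sound (a , b) (c , d) eq with ∧-true (a ≡ᵇ c) eq
... | p , q = cong₂ _,_ (≡ᵇ-sound a c p) (≡ᵇ-sound b d q)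

eqV-refl : ∀ v → eqV v v ≡ true
eqV-refl (a , b) = cong₂ _∧_ (≡ᵇ-refl a) (≡ᵇ-refl b)

eqE-sound : ∀ e f → eqE e f ≡ true → e ≡ f
eqE-sound (v , s) (w , t) eq with ∧-true (eqV v w) eq
eqE-sound (v , R) (w , R) eq | p , q = cong (_, R) (eqV-sound v w p)
eqE-sound (v , U) (w , U) eq | p , q = cong (_, U) (eqV-sound v w p)

eqE-refl : ∀ e → eqE e e ≡ true
eqE-refl (v , R) = cong₂ _∧_ (eqV-refl v) refl
eqE-refl (v , U) = cong₂ _∧_ (eqV-refl v) refl

memV⁻ : ∀ v xs → memV v xs ≡ true → v ∈ xs
memV⁻ v xs eq with any⁻ (eqV v) xs eq
... | w , w∈ , p = subst (_∈ xs) (sym (eqV-sound v w p)) w∈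

memV⁺ : ∀ {v xs} → v ∈ xs → memV v xs ≡ true
memV⁺ {v} v∈ = any⁺ (eqV v) v∈ (eqV-refl v)

memE⁻ : ∀ e xs → memE e xs ≡ true → e ∈ xs
memE⁻ e xs eq with any⁻ (eqE e) xs eq
... | w , w∈ , p = subst (_∈ xs) (sym (eqE-sound e w p)) w∈

memE⁺ : ∀ {e xs} → e ∈ xs → memE e xs ≡ true
memE⁺ {e} e∈ = any⁺ (eqE e) e∈ (eqE-refl e)

deg : Vertex → ℕ
deg (i , j) = i + j

deg-move : ∀ v s → deg (move v s) ≡ suc (deg v)
deg-move (i , j) R = refl
deg-move (i , j) U = +-suc i j

src∈ : ∀ v p {e} → e ∈ edgesFrom v p → proj₁ e ∈ vertsFrom v p
src∈ v (s ∷ p) (here refl) = here refl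
src∈ v (s ∷ p) (there e∈) = there (src∈ (move v s) p e∈)

start∈ : ∀ v p → v ∈ vertsFrom v p
start∈ v [] = here refl
start∈ v (s ∷ p) = here refl

tgt∈ : ∀ v p {w s} → (w , s) ∈ edgesFrom v p → move w s ∈ vertsFrom v p
tgt∈ v (s ∷ p) (here refl) = there (start∈ (move v s) p)
tgt∈ v (s ∷ p) (there e∈) = there (tgt∈ (move v s) p e∈)

outgoing : ∀ v p {w} → w ∈ vertsFrom v p → w ≡ endpoint v p ⊎ ∃ λ s → (w , s) ∈ edgesFrom v p
outgoing v [] (here refl) = inj₁ refl
outgoing v (s ∷ p) (here refl) = inj₂ (s , here refl)
outgoing v (s ∷ p) (there w∈) with outgoing (move v s) p w∈
... | inj₁ eq = inj₁ eq
... | inj₂ (s′ , e∈) = inj₂ (s′ , there e∈)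

incoming : ∀ v p {w} → w ∈ vertsFrom v p →
  w ≡ v ⊎ ∃ λ x → ∃ λ s → move x s ≡ w × (x , s) ∈ edgesFrom v p
incoming v [] (here refl) = inj₁ refl
incoming v (s ∷ p) (here refl) = inj₁ refl
incoming v (s ∷ p) (there w∈) with incoming (move v s) p w∈
... | inj₁ refl = inj₂ (v , s , refl , here refl)
... | inj₂ (x , s′ , eq , e∈) = inj₂ (x , s′ , eq , there e∈)

deg-endpoint : ∀ v p → deg (endpoint v p) ≡ deg v + length p
deg-endpoint v [] = sym (+-identityʳ (deg v))
deg-endpoint v (s ∷ p) =
  trans (deg-endpoint (move v s) p) (trans (cong (_+ length p) (deg-move v s)) (sym (+-suc (deg v) (length p))))

_≤V_ : Vertex → Vertex → Set
(a , b) ≤V (c , d) = a ≤ c × b ≤ d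

≤V-move : ∀ v s {w} → move v s ≤V w → v ≤V w
≤V-move v R (p , q) = <⇒≤ p , q
≤V-move v U (p , q) = p , <⇒≤ q

start≤end : ∀ v p → v ≤V endpoint v p
start≤end v [] = ≤-refl , ≤-refl
start≤end v (s ∷ p) = ≤V-move v s (start≤end (move v s) p)

verts≤end : ∀ v p {w} → w ∈ vertsFrom v p → w ≤V endpoint v p
verts≤end v [] (here refl) = ≤-refl , ≤-refl
verts≤end v (s ∷ p) (here refl) = start≤end v (s ∷ p)
verts≤end v (s ∷ p) (there w∈) = verts≤end (move v s) p w∈

endpoint-++ : ∀ v p q → endpoint v (p ++ q) ≡ endpoint (endpoint v p) q
endpoint-++ v [] q = refl
endpoint-++ v (s ∷ p) q = endpoint-++ (move v s) p q

edges-++ : ∀ v p q → edgesFrom v (p ++ q) ≡ edgesFrom v p ++ edgesFrom (endpoint v p) q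
edges-++ v [] q = refl
edges-++ v (s ∷ p) q = cong ((v , s) ∷_) (edges-++ (move v s) p q)

mid∈ : ∀ v p q → endpoint v p ∈ vertsFrom v (p ++ q)
mid∈ v [] q = start∈ v q
mid∈ v (s ∷ p) q = there (mid∈ (move v s) p q)

words⁻ : ∀ n {p} → p ∈ words n → length p ≡ n
words⁻ zero (here refl) = refl
words⁻ (suc n) p∈ with find (∈-concatMap⁻ (λ w → (R ∷ w) ∷ (U ∷ w) ∷ []) {xs = words n} p∈)
... | w , w∈ , here refl = cong suc (words⁻ n w∈)
... | w , w∈ , there (here refl) = cong suc (words⁻ n w∈)

words⁺ : ∀ p → p ∈ words (length p)
words⁺ [] = here refl
words⁺ (s ∷ p) = ∈-concatMap⁺ (λ w → (R ∷ w) ∷ (U ∷ w) ∷ []) (lose (words⁺ p) (branch s))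
  where
  branch : ∀ s → (s ∷ p) ∈ (R ∷ p) ∷ (U ∷ p) ∷ []
  branch R = here refl
  branch U = there (here refl)

-- Terminal positions and positive paths

nth : {A : Set} → A → List A → ℕ → A
nth x [] i = x
nth x (y ∷ ys) zero = y
nth x (y ∷ ys) (suc i) = nth x ys i

nth-< : ∀ xs i → nth false xs i ≡ true → i < length xs
nth-< (x ∷ xs) zero eq = s≤s z≤n
nth-< (x ∷ xs) (suc i) eq = s≤s (nth-< xs i eq)

nth-zeros : ∀ k S i → nth false (replicate k false ++ S) (k + i) ≡ nth false S i
nth-zeros zero S i = refl
nth-zeros (suc k) S i = nth-zeros k S i

nth-zeros⁻ : ∀ k S i → nth false (replicate k false ++ S) i ≡ true →
  ∃ λ j → i ≡ k + j × nth false S j ≡ true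
nth-zeros⁻ zero S i eq = i , refl , eq
nth-zeros⁻ (suc k) S (suc i) eq with nth-zeros⁻ k S i eq
... | j , p , q = j , cong suc p , q

partialSums : ℕ → List ℕ → List ℕ
partialSums c k = scanl _+_ c (strip k)

start∈partialSums : ∀ c ks → c ∈ scanl _+_ c ks
start∈partialSums c [] = here refl
start∈partialSums c (k ∷ ks) = here refl

-- Each block of `bits` starts at a partial sum of the parts. The offset `c` is the accumulator of
-- `scanl`.
partialSums⁺ : ∀ k c i → nth false (bits k) i ≡ true → c + i ∈ partialSums c k
partialSums⁺ [] c zero eq = here (+-identityʳ c)
partialSums⁺ (zero ∷ ks) c i eq = partialSums⁺ ks c i eq
partialSums⁺ (suc k ∷ ks) c zero eq = here (+-identityʳ c)
partialSums⁺ (suc k ∷ ks) c (suc i) eq with nth-zeros⁻ k (bits ks) i eq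
... | j , refl , q = there (subst (_∈ partialSums (c + suc k) ks) (+-assoc c (suc k) j) (partialSums⁺ ks (c + suc k) j q))

partialSums⁻ : ∀ k c x → x ∈ partialSums c k → ∃ λ i → x ≡ c + i × nth false (bits k) i ≡ true
partialSums⁻ [] c x (here refl) = 0 , sym (+-identityʳ c) , refl
partialSums⁻ (zero ∷ ks) c x x∈ = partialSums⁻ ks c x x∈
partialSums⁻ (suc k ∷ ks) c x (here refl) = 0 , sym (+-identityʳ c) , refl
partialSums⁻ (suc k ∷ ks) c x (there x∈) with partialSums⁻ ks (c + suc k) x x∈
... | i , refl , q = suc k + i , +-assoc c (suc k) i , trans (nth-zeros k (bits ks) i) q

bits-< : ∀ k i → nth false (bits k) i ≡ true → i ≤ total k
bits-< k i eq = s≤s⁻¹ (subst (i <_) (length-bits k) (nth-< (bits k) i eq))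

terminals⁺ : ∀ k v → deg v ≡ total k → nth false (bits k) (proj₁ v) ≡ true → v ∈ terminals k
terminals⁺ k (i , j) deq eq = subst (_∈ terminals k) (cong (i ,_) (trans (cong (_∸ i) (sym deq)) (m+n∸m≡n i j)))
  (∈-map⁺ (λ ni → (ni , total k ∸ ni)) (partialSums⁺ k 0 i eq))

terminals⁻ : ∀ k v → v ∈ terminals k → deg v ≡ total k × nth false (bits k) (proj₁ v) ≡ true
terminals⁻ k v v∈ with ∈-map⁻ (λ ni → (ni , total k ∸ ni)) v∈
... | x , x∈ , refl with partialSums⁻ k 0 x x∈
... | i , refl , q = m+[n∸m]≡n (bits-< k i q) , q

positive⁻ : ∀ k p → p ∈ positivePaths k → length p ≡ total k × endpoint origin p ∈ terminals k
positive⁻ k p p∈ with filterᵇ⁻ (isPositive k) {xs = words (total k)} p∈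
... | q , eq = words⁻ (total k) q ,
  memV⁻ _ (terminals k) (proj₂ (∧-true (all (inΓ k) (vertsFrom origin p)) eq))

-- Every vertex of a path is coordinatewise below its endpoint, so a path that ends at a terminal
-- stays inside Γ.
positive⁺ : ∀ k p → length p ≡ total k → endpoint origin p ∈ terminals k → p ∈ positivePaths k
positive⁺ k p leq t∈ = filterᵇ⁺ (isPositive k) (subst (λ n → p ∈ words n) leq (words⁺ p))
  (cong₂ _∧_ (all⁺ (inΓ k) _ (λ v v∈ → any⁺ _ t∈ (cong₂ _∧_
     (≤ᵇ-true (proj₁ (verts≤end origin p v∈))) (≤ᵇ-true (proj₂ (verts≤end origin p v∈))))))
   (memV⁺ t∈))
  where
  ≤ᵇ-true : ∀ {m n} → m ≤ n → (m ≤ᵇ n) ≡ true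
  ≤ᵇ-true m≤n = Equivalence.to T-≡ (≤⇒≤ᵇ m≤n)

onPath : List (List Step) → Vertex → Bool
onPath P v = any (λ p → memV v (vertsFrom origin p)) P

alongPath : List (List Step) → Edge → Bool
alongPath P e = any (λ p → memE e (edgesFrom origin p)) P

-- The value at the origin makes `isReached` say at once that the origin is present and that every
-- other vertex has an incoming edge. Vertices on an axis have a single candidate for it.
reached : (Edge → Bool) → Vertex → Bool
reached E (zero , zero) = true
reached E (zero , suc j) = E ((zero , j) , U)
reached E (suc i , zero) = E ((i , zero) , R)
reached E (suc i , suc j) = E ((i , suc j) , R) ∨ E ((suc i , j) , U)

-- A union of positive paths covering the terminals, in local terms.
record IsFace (n : ℕ) (top : List Bool) (V : Vertex → Bool) (E : Edge → Bool) : Set where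
  field
    bounded : ∀ v → V v ≡ true → deg v ≤ n
    edgeBounded : ∀ v s → E (v , s) ≡ true → deg v < n
    continues : ∀ v → deg v < n → V v ≡ E (v , U) ∨ E (v , R)
    isReached : ∀ v → deg v ≤ n → V v ≡ reached E v
    onTop : ∀ v → deg v ≡ n → V v ≡ nth false top (proj₁ v)

reached⁺ : ∀ E v s → E (v , s) ≡ true → reached E (move v s) ≡ true
reached⁺ E (i , zero) R eq = eq
reached⁺ E (i , suc j) R eq = ∨-trueˡ _ eq
reached⁺ E (zero , j) U eq = eq
reached⁺ E (suc i , j) U eq = ∨-trueʳ (E ((i , suc j) , R)) eq

reached⁻ : ∀ E v → reached E v ≡ true → v ≡ origin ⊎ ∃ λ x → ∃ λ s → move x s ≡ v × E (x , s) ≡ true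
reached⁻ E (zero , zero) eq = inj₁ refl
reached⁻ E (zero , suc j) eq = inj₂ (_ , U , refl , eq)
reached⁻ E (suc i , zero) eq = inj₂ (_ , R , refl , eq)
reached⁻ E (suc i , suc j) eq with ∨-true (E ((i , suc j) , R)) eq
... | inj₁ p = inj₂ (_ , R , refl , p)
... | inj₂ p = inj₂ (_ , U , refl , p)

someStep⁺ : ∀ (E : Edge → Bool) v s → E (v , s) ≡ true → E (v , U) ∨ E (v , R) ≡ true
someStep⁺ E v R eq = ∨-trueʳ (E (v , U)) eq
someStep⁺ E v U eq = ∨-trueˡ _ eq

someStep⁻ : ∀ (E : Edge → Bool) v → E (v , U) ∨ E (v , R) ≡ true → ∃ λ s → E (v , s) ≡ true
someStep⁻ E v eq with ∨-true (E (v , U)) eq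
... | inj₁ p = U , p
... | inj₂ p = R , p

-- Each condition is inherited from a single path through the vertex or edge. On the top
-- antidiagonal a path has only its endpoint, a terminal, and conversely all terminals are covered.
isFace-union : ∀ k P → (∀ p → p ∈ P → p ∈ positivePaths k) → coversTerminals k P ≡ true →
  IsFace (total k) (bits k) (onPath P) (alongPath P)
isFace-union k P positive covers = record
  { bounded = λ v eq → let p , p∈ , v∈ = onPath⁻ v eq in bound p p∈ v∈
  ; edgeBounded = λ v s eq → let p , p∈ , e∈ = alongPath⁻ (v , s) eq in
      subst (_≤ total k) (deg-move v s) (bound p p∈ (tgt∈ origin p e∈))
  ; continues = λ v v<n → bool-ext (cont v v<n)
      (λ eq → let s , q = someStep⁻ (alongPath P) v eq
                  p , p∈ , e∈ = alongPath⁻ (v , s) q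
              in onPath⁺ p∈ (src∈ origin p e∈))
  ; isReached = λ v _ → bool-ext (reach v) (λ eq → unreach v (reached⁻ (alongPath P) v eq))
  ; onTop = λ v v≡n → bool-ext
      (λ eq → let p , p∈ , v∈ = onPath⁻ v eq in
        proj₂ (terminals⁻ k v (subst (_∈ terminals k) (sym (atEnd p p∈ v∈ v≡n)) (proj₂ (pos⁻ p∈)))))
      (λ eq → all⁻ (onPath P) covers (terminals⁺ k v v≡n eq))
  }
  where
  onPath⁻ : ∀ v → onPath P v ≡ true → ∃ λ p → p ∈ P × v ∈ vertsFrom origin p
  onPath⁻ v eq with any⁻ (λ p → memV v (vertsFrom origin p)) P eq
  ... | p , p∈ , q = p , p∈ , memV⁻ v _ q
  onPath⁺ : ∀ {v p} → p ∈ P → v ∈ vertsFrom origin p → onPath P v ≡ true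
  onPath⁺ {v} p∈ v∈ = any⁺ (λ p → memV v (vertsFrom origin p)) p∈ (memV⁺ v∈)
  alongPath⁻ : ∀ e → alongPath P e ≡ true → ∃ λ p → p ∈ P × e ∈ edgesFrom origin p
  alongPath⁻ e eq with any⁻ (λ p → memE e (edgesFrom origin p)) P eq
  ... | p , p∈ , q = p , p∈ , memE⁻ e _ q
  alongPath⁺ : ∀ {e p} → p ∈ P → e ∈ edgesFrom origin p → alongPath P e ≡ true
  alongPath⁺ {e} p∈ e∈ = any⁺ (λ p → memE e (edgesFrom origin p)) p∈ (memE⁺ e∈)
  pos⁻ : ∀ {p} → p ∈ P → length p ≡ total k × endpoint origin p ∈ terminals k
  pos⁻ {p} p∈ = positive⁻ k p (positive p p∈)
  degEnd : ∀ p → p ∈ P → deg (endpoint origin p) ≡ total k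
  degEnd p p∈ = trans (deg-endpoint origin p) (proj₁ (pos⁻ p∈))
  bound : ∀ p → p ∈ P → ∀ {v} → v ∈ vertsFrom origin p → deg v ≤ total k
  bound p p∈ v∈ with verts≤end origin p v∈
  ... | a≤ , b≤ = subst (_ ≤_) (degEnd p p∈) (+-mono-≤ a≤ b≤)
  cont : ∀ v → deg v < total k → onPath P v ≡ true → alongPath P (v , U) ∨ alongPath P (v , R) ≡ true
  cont v v<n eq with onPath⁻ v eq
  ... | p , p∈ , v∈ with outgoing origin p v∈
  ... | inj₁ refl = ⊥-elim (<-irrefl (degEnd p p∈) v<n)
  ... | inj₂ (s , e∈) = someStep⁺ (alongPath P) v s (alongPath⁺ p∈ e∈)
  reach : ∀ v → onPath P v ≡ true → reached (alongPath P) v ≡ true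
  reach v eq with onPath⁻ v eq
  ... | p , p∈ , v∈ with incoming origin p v∈
  ... | inj₁ refl = refl
  ... | inj₂ (x , s , refl , e∈) = reached⁺ (alongPath P) x s (alongPath⁺ p∈ e∈)
  unreach : ∀ v → v ≡ origin ⊎ (∃ λ x → ∃ λ s → move x s ≡ v × alongPath P (x , s) ≡ true) → onPath P v ≡ true
  unreach v (inj₂ (x , s , refl , eq)) with alongPath⁻ (x , s) eq
  ... | p , p∈ , e∈ = onPath⁺ p∈ (tgt∈ origin p e∈)
  -- The origin lies on the union because the terminal `(0 , total k)` must be covered, so `P`
  -- contains a path.
  unreach v (inj₁ refl) with onPath⁻ (0 , total k) (all⁻ (onPath P) covers (∈-map⁺ (λ ni → (ni , total k ∸ ni)) (start∈partialSums 0 (strip k))))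
  ... | p , p∈ , _ = onPath⁺ p∈ (start∈ origin p)
  atEnd : ∀ p → p ∈ P → ∀ {v} → v ∈ vertsFrom origin p → deg v ≡ total k → v ≡ endpoint origin p
  atEnd p p∈ {v} v∈ v≡n with outgoing origin p v∈
  ... | inj₁ eq = eq
  ... | inj₂ (s , e∈) = ⊥-elim (<-irrefl v≡n
      (subst (_≤ total k) (deg-move v s) (bound p p∈ (tgt∈ origin p e∈))))

-- From the local conditions back to positive paths

module _ {n top V E} (F : IsFace n top V E) where
  open IsFace F

  edge-src : ∀ v s → E (v , s) ≡ true → V v ≡ true
  edge-src v s eq = trans (continues v (edgeBounded v s eq)) (someStep⁺ E v s eq)

  edge-tgt : ∀ v s → E (v , s) ≡ true → V (move v s) ≡ true
  edge-tgt v s eq = trans (isReached (move v s) (subst (_≤ n) (sym (deg-move v s)) (edgeBounded v s eq)))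
    (reached⁺ E v s eq)

  -- Incoming edges are followed backwards; each lowers the degree by one, so the walk stops at the
  -- origin. `pathFrom` follows outgoing edges up to degree n in the same way.
  pathTo : ∀ m v → deg v ≡ m → V v ≡ true →
    ∃ λ p → endpoint origin p ≡ v × (∀ e → e ∈ edgesFrom origin p → E e ≡ true)
  pathTo m v deq eq with reached⁻ E v (trans (sym (isReached v (bounded v eq))) eq)
  ... | inj₁ refl = [] , refl , λ e ()
  pathTo zero v deq eq | inj₂ (x , s , refl , p) with trans (sym (deg-move x s)) deq
  ... | ()
  pathTo (suc m) v deq eq | inj₂ (x , s , refl , p)
    with pathTo m x (suc-injective (trans (sym (deg-move x s)) deq)) (edge-src x s p)
  ... | q , refl , inE = q ++ s ∷ [] , endpoint-++ origin q (s ∷ []) , inE′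
    where
    inE′ : ∀ e → e ∈ edgesFrom origin (q ++ s ∷ []) → E e ≡ true
    inE′ e e∈ with ∈-++⁻ (edgesFrom origin q) (subst (e ∈_) (edges-++ origin q (s ∷ [])) e∈)
    ... | inj₁ e∈′ = inE e e∈′
    ... | inj₂ (here refl) = p

  pathFrom : ∀ m v → m + deg v ≡ n → V v ≡ true →
    ∃ λ p → V (endpoint v p) ≡ true × length p ≡ m × (∀ e → e ∈ edgesFrom v p → E e ≡ true)
  pathFrom zero v deq eq = [] , eq , refl , λ e ()
  pathFrom (suc m) v deq eq
    with someStep⁻ E v (trans (sym (continues v (subst (deg v <_) deq (s≤s (m≤n+m (deg v) m))))) eq)
  ... | s , q with pathFrom m (move v s) (trans (cong (m +_) (deg-move v s)) (trans (+-suc m (deg v)) deq)) (edge-tgt v s q)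
  ... | p , end , len , inE = s ∷ p , end , cong suc len , λ where
    e (here refl) → q
    e (there e∈) → inE e e∈

  along-V : ∀ v p → V v ≡ true → (∀ e → e ∈ edgesFrom v p → E e ≡ true) →
    ∀ {w} → w ∈ vertsFrom v p → V w ≡ true
  along-V v p eq inE w∈ with incoming v p w∈
  ... | inj₁ refl = eq
  ... | inj₂ (x , s , refl , e∈) = edge-tgt x s (inE _ e∈)

  origin-V : V origin ≡ true
  origin-V = isReached origin z≤n

-- The largest set of positive paths inside the subgraph. As a filtered list it occurs among the
-- `sublists` that `faces` runs over.
facePaths : List ℕ → (Edge → Bool) → List (List Step)
facePaths k E = filterᵇ (λ p → all E (edgesFrom origin p)) (positivePaths k)

module _ k {V E} (F : IsFace (total k) (bits k) V E) where
  open IsFace F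

  private
    n = total k

    facePath⁺ : ∀ v p q → endpoint origin p ≡ v → length q + deg v ≡ n → V (endpoint v q) ≡ true →
      (∀ e → e ∈ edgesFrom origin p → E e ≡ true) → (∀ e → e ∈ edgesFrom v q → E e ≡ true) →
      p ++ q ∈ facePaths k E
    facePath⁺ v p q refl len end pE qE = filterᵇ⁺ _
      (positive⁺ k (p ++ q) len′ (terminals⁺ k _ dEnd (trans (sym (onTop _ dEnd)) (trans (cong V (endpoint-++ origin p q)) end))))
      (all⁺ E _ inE)
      where
      len′ : length (p ++ q) ≡ n
      len′ = trans (length-++ p) (trans (cong (_+ length q) (sym (deg-endpoint origin p))) (trans (+-comm _ (length q)) len))
      dEnd : deg (endpoint origin (p ++ q)) ≡ n
      dEnd = trans (deg-endpoint origin (p ++ q)) len′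
      inE : ∀ e → e ∈ edgesFrom origin (p ++ q) → E e ≡ true
      inE e e∈ with ∈-++⁻ (edgesFrom origin p) (subst (e ∈_) (edges-++ origin p q) e∈)
      ... | inj₁ e∈′ = pE e e∈′
      ... | inj₂ e∈′ = qE e e∈′

    facePath⁻ : ∀ {p} → p ∈ facePaths k E → ∀ e → e ∈ edgesFrom origin p → E e ≡ true
    facePath⁻ {p} p∈ e e∈ = all⁻ E (proj₂ (filterᵇ⁻ _ {xs = positivePaths k} p∈)) e∈

  -- A path from the origin to the vertex is joined to one from the vertex to the top, where `onTop`
  -- makes the endpoint a terminal. For edges the two pieces are joined through the edge itself.
  onPath-facePaths : ∀ v → onPath (facePaths k E) v ≡ V v
  onPath-facePaths v = bool-ext
    (λ eq → let p , p∈ , q = any⁻ (λ p → memV v (vertsFrom origin p)) (facePaths k E) eq in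
      along-V F origin p (origin-V F) (facePath⁻ p∈) (memV⁻ v _ q))
    (λ eq → let p , pv , pE = pathTo F (deg v) v refl eq
                q , end , len , qE = pathFrom F (n ∸ deg v) v (m∸n+n≡m (bounded v eq)) eq
            in any⁺ (λ p → memV v (vertsFrom origin p))
                 (facePath⁺ v p q pv (trans (cong (_+ deg v) len) (m∸n+n≡m (bounded v eq))) end pE qE)
                 (memV⁺ (subst (_∈ vertsFrom origin (p ++ q)) pv (mid∈ origin p q))))

  alongPath-facePaths : ∀ e → alongPath (facePaths k E) e ≡ E e
  alongPath-facePaths (v , s) = bool-ext
    (λ eq → let p , p∈ , q = any⁻ (λ p → memE (v , s) (edgesFrom origin p)) (facePaths k E) eq in
      facePath⁻ p∈ (v , s) (memE⁻ (v , s) _ q))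
    through
    where
    through : E (v , s) ≡ true → alongPath (facePaths k E) (v , s) ≡ true
    through eq with pathTo F (deg v) v refl (edge-src F v s eq)
    ... | p , refl , pE with edge-tgt F v s eq
    ... | w∈V with m∸n+n≡m (bounded _ w∈V)
    ... | deq with pathFrom F (n ∸ deg (move v s)) (move v s) deq w∈V
    ... | q , end , len , qE =
      any⁺ (λ p → memE (v , s) (edgesFrom origin p))
        (facePath⁺ v p (s ∷ q) refl
          (trans (sym (+-suc (length q) (deg v))) (trans (cong₂ _+_ len (sym (deg-move v s))) deq))
          end pE λ where
            e (here refl) → eq
            e (there e∈) → qE e e∈)
        (memE⁺ (subst ((v , s) ∈_) (sym (edges-++ origin p (s ∷ q))) (∈-++⁺ʳ (edgesFrom origin p) (here refl))))

  facePaths-cover : coversTerminals k (facePaths k E) ≡ true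
  facePaths-cover = all⁺ (onPath (facePaths k E)) (terminals k) λ t t∈ →
    let deq , eq = terminals⁻ k t t∈ in trans (onPath-facePaths t) (trans (onTop t deq) eq)

-- Level-by-level description of faces

levels⁻ : ∀ u ts {e : Level} → e ∈ levels u ts → ∃ λ r → ∃ λ e′ → e ≡ (u , r) ∷ e′ × targetsFrom r e′ ≡ ts
levels-∷⁻ : ∀ u r u′ ts {e : Level} → e ∈ map ((u , r) ∷_) (levels u′ ts) →
  ∃ λ e′ → e ≡ (u , r) ∷ e′ × e′ ∈ levels u′ ts × targetsFrom r e′ ≡ (r ∨ u′) ∷ ts

levels⁻ u (t ∷ []) (here refl) = t , [] , refl , refl
levels⁻ u (false ∷ ts@(_ ∷ _)) e∈ with levels-∷⁻ u false false ts e∈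
... | e′ , p , _ , q = false , e′ , p , q
levels⁻ u (true ∷ ts@(_ ∷ _)) e∈ with ∈-++⁻ (map ((u , false) ∷_) (levels true ts)) e∈
... | inj₁ e∈₁ with levels-∷⁻ u false true ts e∈₁
... | e′ , p , _ , q = false , e′ , p , q
levels⁻ u (true ∷ ts@(_ ∷ _)) e∈ | inj₂ e∈₂ with ∈-++⁻ (map ((u , true) ∷_) (levels false ts)) e∈₂
... | inj₁ e∈₃ = let e′ , p , _ , q = levels-∷⁻ u true false ts e∈₃ in true , e′ , p , q
... | inj₂ e∈₃ = let e′ , p , _ , q = levels-∷⁻ u true true ts e∈₃ in true , e′ , p , q

levels-∷⁻ u r u′ ts e∈ with ∈-map⁻ ((u , r) ∷_) e∈
... | e′ , e′∈ , refl with levels⁻ u′ ts e′∈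
... | r′ , e″ , refl , q = e′ , refl , e′∈ , cong (_ ∷_) q

levels⁺ : ∀ u r e → (u , r) ∷ e ∈ levels u (targetsFrom r e)
levels⁺ u r [] = here refl
levels⁺ u r ((u′ , r′) ∷ e) with targetsFrom r′ e in eq | levels⁺ u′ r′ e
levels⁺ u false ((false , r′) ∷ e) | _ ∷ _ | ih = ∈-map⁺ _ ih
levels⁺ u false ((true , r′) ∷ e) | ts@(_ ∷ _) | ih = ∈-++⁺ˡ (∈-map⁺ _ ih)
levels⁺ u true ((false , r′) ∷ e) | ts@(_ ∷ _) | ih =
  ∈-++⁺ʳ (map ((u , false) ∷_) (levels true ts)) (∈-++⁺ˡ (∈-map⁺ _ ih))
levels⁺ u true ((true , r′) ∷ e) | ts@(_ ∷ _) | ih =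
  ∈-++⁺ʳ (map ((u , false) ∷_) (levels true ts)) (∈-++⁺ʳ (map ((u , true) ∷_) (levels false ts)) (∈-map⁺ _ ih))

-- The right bit of the first entry separates the first block from the other two, and the up bit of
-- the second entry separates those from each other.
levels-unique : ∀ u ts → Unique (levels u ts)
levels-unique u [] = []
levels-unique u (t ∷ []) = [] ∷ []
levels-unique u (false ∷ ts@(_ ∷ _)) = map⁺ ∷-injectiveʳ (levels-unique false ts)
levels-unique u (true ∷ ts@(_ ∷ _)) =
  ++⁺ (map⁺ ∷-injectiveʳ (levels-unique true ts))
      (++⁺ (map⁺ ∷-injectiveʳ (levels-unique false ts)) (map⁺ ∷-injectiveʳ (levels-unique true ts)) lastTwo)
      firstRest
  where
  lastTwo : Disjoint (map ((u , true) ∷_) (levels false ts)) (map ((u , true) ∷_) (levels true ts))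
  lastTwo (p , q) with levels-∷⁻ u true false ts p | levels-∷⁻ u true true ts q
  ... | e , refl , e∈ , _ | .e , refl , e∈′ , _ with levels⁻ false ts e∈ | levels⁻ true ts e∈′
  ... | _ , _ , refl , _ | _ , _ , () , _
  firstRest : Disjoint (map ((u , false) ∷_) (levels true ts)) (map ((u , true) ∷_) (levels false ts) ++ map ((u , true) ∷_) (levels true ts))
  firstRest (p , q) with levels-∷⁻ u false true ts p | ∈-++⁻ (map ((u , true) ∷_) (levels false ts)) q
  ... | e , refl , _ | inj₁ q′ with levels-∷⁻ u true false ts q′
  ... | _ , () , _
  firstRest (p , q) | e , refl , _ | inj₂ q′ with levels-∷⁻ u true true ts q′
  ... | _ , () , _

concatMap-∷-unique : {A : Set} (K : A → List (List A)) → (∀ e → Unique (K e)) →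
  ∀ {es} → Unique es → Unique (concatMap (λ e → map (e ∷_) (K e)) es)
concatMap-∷-unique K uK [] = []
concatMap-∷-unique K uK {e ∷ es} (e∉ ∷ u) = ++⁺ (map⁺ ∷-injectiveʳ (uK e)) (concatMap-∷-unique K uK u) disjoint
  where
  disjoint : Disjoint (map (e ∷_) (K e)) (concatMap (λ e′ → map (e′ ∷_) (K e′)) es)
  disjoint (p , q) with ∈-map⁻ (e ∷_) p | find (∈-concatMap⁻ (λ e′ → map (e′ ∷_) (K e′)) {xs = es} q)
  ... | _ , _ , refl | e′ , e′∈ , q′ with ∈-map⁻ (e′ ∷_) q′
  ... | _ , _ , eq = All.lookup e∉ e′∈ (∷-injectiveˡ eq)

levelFaces-unique : ∀ n ts → Unique (levelFaces n ts)
levelFaces-unique zero [] = []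
levelFaces-unique zero (false ∷ ts) = []
levelFaces-unique zero (true ∷ []) = [] ∷ []
levelFaces-unique zero (true ∷ _ ∷ _) = []
levelFaces-unique (suc n) [] = []
levelFaces-unique (suc n) (t ∷ ts) =
  concatMap-∷-unique (levelFaces n ∘ sources) (levelFaces-unique n ∘ sources) (levels-unique t ts)

data LevelFace : List Bool → Face → Set where
  base : LevelFace (true ∷ []) []
  step : ∀ {top e γ} → targets e ≡ top → length e ≡ suc (length γ) →
    LevelFace (sources e) γ → LevelFace top (e ∷ γ)

length-targets : ∀ r e → length (targetsFrom r e) ≡ suc (length e)
length-targets r [] = refl
length-targets r ((u , r′) ∷ e) = cong suc (length-targets r′ e)

length-top : ∀ {top γ} → LevelFace top γ → length top ≡ suc (length γ)
length-top base = refl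
length-top (step {e = e} refl len _) = trans (length-targets false e) (cong suc len)

levelFaces⁻ : ∀ n ts {γ} → γ ∈ levelFaces n ts → LevelFace ts γ × length γ ≡ n
levelFaces⁻ zero (true ∷ []) (here refl) = base , refl
levelFaces⁻ (suc n) (t ∷ ts) γ∈
  with find (∈-concatMap⁻ (λ e → map (e ∷_) (levelFaces n (sources e))) {xs = levels t ts} γ∈)
... | e , e∈ , γ∈′ with ∈-map⁻ (e ∷_) γ∈′
... | γ , γ∈″ , refl with levelFaces⁻ n (sources e) γ∈″ | levels⁻ t ts e∈
... | F , len | r , e′ , refl , eq =
  step (cong (t ∷_) eq) (trans (sym (length-map _ ((t , r) ∷ e′))) (length-top F)) F , cong suc len

levelFaces⁺ : ∀ {top γ} → LevelFace top γ → γ ∈ levelFaces (length γ) top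
levelFaces⁺ base = here refl
levelFaces⁺ (step {e = (u , r) ∷ e} {γ} refl len F) =
  ∈-concatMap⁺ (λ e → map (e ∷_) (levelFaces (length γ) (sources e)))
    (lose (levels⁺ u r e) (∈-map⁺ (((u , r) ∷ e) ∷_) (levelFaces⁺ F)))

-- Levels are stored from the top down, so the head of `e ∷ γ` leaves the antidiagonal of degree
-- `length γ`. Degrees outside the face give the empty level, hence no edges.
row : Face → ℕ → Level
row [] m = []
row (e ∷ γ) m = if m ≡ᵇ length γ then e else row γ m

-- No edge leaves the top antidiagonal, so its row is given separately instead of being read off as
-- sources.
vertexRow : List Bool → Face → ℕ → List Bool
vertexRow top γ m = if m ≡ᵇ length γ then top else sources (row γ m)

bitsAt : Level → ℕ → Bool × Bool
bitsAt = nth (false , false)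

faceE : Face → Edge → Bool
faceE γ ((i , j) , U) = proj₁ (bitsAt (row γ (i + j)) i)
faceE γ ((i , j) , R) = proj₂ (bitsAt (row γ (i + j)) i)

faceV : List Bool → Face → Vertex → Bool
faceV top γ (i , j) = nth false (vertexRow top γ (i + j)) i

≢⇒≡ᵇ-false : ∀ {m n} → ¬ m ≡ n → (m ≡ᵇ n) ≡ false
≢⇒≡ᵇ-false {m} {n} m≢n with m ≡ᵇ n in eq
... | true = ⊥-elim (m≢n (≡ᵇ-sound m n eq))
... | false = refl

row-top : ∀ e γ → row (e ∷ γ) (length γ) ≡ e
row-top e γ rewrite ≡ᵇ-refl (length γ) = refl

row-below : ∀ e γ {m} → m < length γ → row (e ∷ γ) m ≡ row γ m
row-below e γ m< rewrite ≢⇒≡ᵇ-false (<⇒≢ m<) = refl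

row-above : ∀ γ {m} → length γ ≤ m → row γ m ≡ []
row-above [] _ = refl
row-above (e ∷ γ) len≤ rewrite ≢⇒≡ᵇ-false (≢-sym (<⇒≢ len≤)) = row-above γ (<⇒≤ len≤)

vertexRow-top : ∀ top γ → vertexRow top γ (length γ) ≡ top
vertexRow-top top γ rewrite ≡ᵇ-refl (length γ) = refl

vertexRow-≢ : ∀ top γ {m} → ¬ m ≡ length γ → vertexRow top γ m ≡ sources (row γ m)
vertexRow-≢ top γ m≢ rewrite ≢⇒≡ᵇ-false m≢ = refl

vertexRow-∷ : ∀ top e γ {m} → m ≤ length γ → vertexRow top (e ∷ γ) m ≡ vertexRow (sources e) γ m
vertexRow-∷ top e γ {m} m≤ with m≤n⇒m<n∨m≡n m≤
... | inj₁ m< = trans (vertexRow-≢ top (e ∷ γ) (<⇒≢ (m<n⇒m<1+n m<)))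
    (trans (cong sources (row-below e γ m<)) (sym (vertexRow-≢ (sources e) γ (<⇒≢ m<))))
... | inj₂ refl = trans (vertexRow-≢ top (e ∷ γ) (<⇒≢ (n<1+n m)))
    (trans (cong sources (row-top e γ)) (sym (vertexRow-top (sources e) γ)))

length-row : ∀ {top γ} → LevelFace top γ → ∀ {m} → m < length γ → length (row γ m) ≡ suc m
length-row (step {e = e} {γ} _ len F) (s≤s m≤) with m≤n⇒m<n∨m≡n m≤
... | inj₁ m< = trans (cong length (row-below e γ m<)) (length-row F m<)
... | inj₂ refl = trans (cong length (row-top e γ)) len

targets-row : ∀ {top γ} → LevelFace top γ → ∀ {m} → m < length γ → vertexRow top γ (suc m) ≡ targets (row γ m)
targets-row (step {top} {e} {γ} eq len F) (s≤s m≤) with m≤n⇒m<n∨m≡n m≤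
... | inj₁ m< = trans (vertexRow-∷ top e γ m<) (trans (targets-row F m<) (cong targets (sym (row-below e γ m<))))
... | inj₂ refl = trans (vertexRow-top top (e ∷ γ)) (trans (sym eq) (cong targets (sym (row-top e γ))))

vertexRow-zero : ∀ {top γ} → LevelFace top γ → vertexRow top γ 0 ≡ true ∷ []
vertexRow-zero base = refl
vertexRow-zero (step {top} {e} {γ} _ _ F) = trans (vertexRow-∷ top e γ z≤n) (vertexRow-zero F)

nth-sources : ∀ e i → nth false (sources e) i ≡ proj₁ (bitsAt e i) ∨ proj₂ (bitsAt e i)
nth-sources [] i = refl
nth-sources (_ ∷ e) zero = refl
nth-sources (_ ∷ e) (suc i) = nth-sources e i

nth-targets-zero : ∀ r e → nth false (targetsFrom r e) 0 ≡ r ∨ proj₁ (bitsAt e 0)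
nth-targets-zero r [] = sym (∨-identityʳ r)
nth-targets-zero r (_ ∷ e) = refl

nth-targets-suc : ∀ r e i → nth false (targetsFrom r e) (suc i) ≡ proj₂ (bitsAt e i) ∨ proj₁ (bitsAt e (suc i))
nth-targets-suc r [] i = refl
nth-targets-suc r ((u , r′) ∷ e) zero = nth-targets-zero r′ e
nth-targets-suc r ((u , r′) ∷ e) (suc i) = nth-targets-suc r′ e i

nth-≥ : {A : Set} (x : A) → ∀ xs {i} → length xs ≤ i → nth x xs i ≡ x
nth-≥ x [] _ = refl
nth-≥ x (y ∷ xs) (s≤s len≤) = nth-≥ x xs len≤

isFace-levelFace : ∀ {top γ} → LevelFace top γ → IsFace (length γ) top (faceV top γ) (faceE γ)
isFace-levelFace {top} {γ} F = record
  { bounded = λ v eq → ≮⇒≥ (vAbove v eq)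
  ; edgeBounded = λ v s eq → ≰⇒> (eAbove v s eq)
  ; continues = λ v v< → trans (cong (λ S → nth false S (proj₁ v)) (vertexRow-≢ top γ (<⇒≢ v<)))
      (nth-sources (row γ (deg v)) (proj₁ v))
  ; isReached = reach
  ; onTop = λ v v≡n → cong (λ S → nth false S (proj₁ v))
      (trans (cong (vertexRow top γ) v≡n) (vertexRow-top top γ))
  }
  where
  vAbove : ∀ v → faceV top γ v ≡ true → ¬ length γ < deg v
  vAbove (i , j) eq n< with trans (sym eq) (cong (λ S → nth false S i)
    (trans (vertexRow-≢ top γ (≢-sym (<⇒≢ n<))) (cong sources (row-above γ (<⇒≤ n<)))))
  ... | ()
  eAbove : ∀ v s → faceE γ (v , s) ≡ true → ¬ length γ ≤ deg v
  eAbove (i , j) U eq n≤ with trans (sym eq) (cong (λ e → proj₁ (bitsAt e i)) (row-above γ n≤))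
  ... | ()
  eAbove (i , j) R eq n≤ with trans (sym eq) (cong (λ e → proj₂ (bitsAt e i)) (row-above γ n≤))
  ... | ()
  reach : ∀ v → deg v ≤ length γ → faceV top γ v ≡ reached (faceE γ) v
  reach (zero , zero) _ = cong (λ S → nth false S 0) (vertexRow-zero F)
  reach (zero , suc j) v≤ = trans (cong (λ S → nth false S 0) (targets-row F v≤)) (nth-targets-zero false (row γ j))
  reach (suc i , zero) v≤ = trans (cong (λ S → nth false S (suc i)) (targets-row F v≤))
    (trans (nth-targets-suc false (row γ (i + 0)) i)
    -- On the horizontal axis there is no edge from below; `targets` reads that bit past the end of
    -- the level, where it defaults to `false`.
    (trans (cong (λ x → faceE γ ((i , 0) , R) ∨ proj₁ x)
       (nth-≥ (false , false) (row γ (i + 0)) (≤-reflexive (trans (length-row F v≤) (cong suc (+-identityʳ i))))))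
       (∨-identityʳ _)))
  reach (suc i , suc j) v≤ = trans (cong (λ S → nth false S (suc i)) (targets-row F v≤))
    (trans (nth-targets-suc false (row γ (i + suc j)) i)
     (cong (λ m → faceE γ ((i , suc j) , R) ∨ proj₁ (bitsAt (row γ m) (suc i))) (+-suc i j)))

module _ {A : Set} (x : A) where

  nth-applyUpTo : ∀ (f : ℕ → A) n {i} → i < n → nth x (applyUpTo f n) i ≡ f i
  nth-applyUpTo f (suc n) {zero} _ = refl
  nth-applyUpTo f (suc n) {suc i} (s≤s i<) = nth-applyUpTo (f ∘ suc) n i<

  applyUpTo-nth : ∀ (f : ℕ → A) n ys → length ys ≡ n → (∀ i → i < n → f i ≡ nth x ys i) → applyUpTo f n ≡ ys
  applyUpTo-nth f zero [] len eq = refl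
  applyUpTo-nth f (suc n) (y ∷ ys) len eq =
    cong₂ _∷_ (eq 0 (s≤s z≤n)) (applyUpTo-nth (f ∘ suc) n ys (suc-injective len) (λ i i< → eq (suc i) (s≤s i<)))

applyUpTo-cong : {A : Set} {f g : ℕ → A} → ∀ n → (∀ i → i < n → f i ≡ g i) → applyUpTo f n ≡ applyUpTo g n
applyUpTo-cong zero eq = refl
applyUpTo-cong (suc n) eq = cong₂ _∷_ (eq 0 (s≤s z≤n)) (applyUpTo-cong n (λ i i< → eq (suc i) (s≤s i<)))

stepsAt : (Edge → Bool) → ℕ → ℕ → Bool × Bool
stepsAt E m i = E ((i , m ∸ i) , U) , E ((i , m ∸ i) , R)

rowOf : (Edge → Bool) → ℕ → Level
rowOf E m = applyUpTo (stepsAt E m) (suc m)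

length-rowOf : ∀ E m → length (rowOf E m) ≡ suc m
length-rowOf E m = length-applyUpTo (stepsAt E m) (suc m)

bitsAt-rowOf : ∀ E m {i} → i ≤ m → bitsAt (rowOf E m) i ≡ stepsAt E m i
bitsAt-rowOf E m i≤ = nth-applyUpTo (false , false) (stepsAt E m) (suc m) (s≤s i≤)

vertexRowOf : (Vertex → Bool) → ℕ → List Bool
vertexRowOf V m = applyUpTo (λ i → V (i , m ∸ i)) (suc m)

faceOf : (Edge → Bool) → ℕ → Face
faceOf E zero = []
faceOf E (suc n) = rowOf E n ∷ faceOf E n

length-faceOf : ∀ E n → length (faceOf E n) ≡ n
length-faceOf E zero = refl
length-faceOf E (suc n) = cong suc (length-faceOf E n)

row-faceOf : ∀ E n {m} → m < n → row (faceOf E n) m ≡ rowOf E m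
row-faceOf E (suc n) (s≤s m≤) with m≤n⇒m<n∨m≡n m≤
... | inj₁ m< = trans (row-below (rowOf E n) (faceOf E n) (subst (_ <_) (sym (length-faceOf E n)) m<)) (row-faceOf E n m<)
... | inj₂ refl = trans (cong (row (faceOf E (suc n))) (sym (length-faceOf E n))) (row-top (rowOf E n) (faceOf E n))

module _ {n top V E} (F : IsFace n top V E) where
  open IsFace F

  -- This is `continues` read along one antidiagonal; `targets-rowOf` is `isReached` read along the
  -- next.
  sources-rowOf : ∀ m → m < n → sources (rowOf E m) ≡ vertexRowOf V m
  sources-rowOf m m< = trans (map-applyUpTo (stepsAt E m) (uncurry _∨_) (suc m))
    (applyUpTo-cong (suc m) λ i i< → sym (continues (i , m ∸ i) (subst (_< n) (sym (m+[n∸m]≡n (s≤s⁻¹ i<))) m<)))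

  targets-rowOf : ∀ m → m < n → targets (rowOf E m) ≡ vertexRowOf V (suc m)
  targets-rowOf m m< = sym (applyUpTo-nth false _ (suc (suc m)) (targets (rowOf E m))
    (trans (length-targets false (rowOf E m)) (cong suc (length-rowOf E m))) eq)
    where
    eq : ∀ i → i < suc (suc m) → V (i , suc m ∸ i) ≡ nth false (targets (rowOf E m)) i
    eq zero _ = isReached (0 , suc m) m<
    eq (suc i) (s≤s (s≤s i≤)) with m≤n⇒∃[o]m+o≡n i≤
    ... | j , refl = trans (trans (cong (λ x → V (suc i , x)) (m+n∸m≡n i j)) (trans (isReached (suc i , j) m<) (atRow j)))
      (sym (nth-targets-suc false (rowOf E (i + j)) i))
      where
      atRow : ∀ j → reached E (suc i , j) ≡ proj₂ (bitsAt (rowOf E (i + j)) i) ∨ proj₁ (bitsAt (rowOf E (i + j)) (suc i))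
      -- The last target again has no edge from below, and the up bit is read past the end of the
      -- row.
      atRow zero = sym (trans (cong₂ (λ x y → proj₂ x ∨ proj₁ y)
          (bitsAt-rowOf E (i + 0) (m≤m+n i 0))
          (nth-≥ (false , false) (rowOf E (i + 0)) (≤-reflexive (trans (length-rowOf E (i + 0)) (cong suc (+-identityʳ i))))))
        (trans (∨-identityʳ _) (cong (λ x → E ((i , x) , R)) (m+n∸m≡n i 0))))
      atRow (suc j) = sym (cong₂ _∨_
        (trans (cong proj₂ (bitsAt-rowOf E (i + suc j) (m≤m+n i (suc j))))
               (cong (λ x → E ((i , x) , R)) (m+n∸m≡n i (suc j))))
        (trans (cong proj₁ (bitsAt-rowOf E (i + suc j) (subst (suc i ≤_) (sym (+-suc i j)) (s≤s (m≤m+n i j)))))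
               (cong (λ x → E ((suc i , x) , U)) (trans (cong (_∸ suc i) (+-suc i j)) (m+n∸m≡n i j)))))

  levelFace-faceOf : ∀ m → m ≤ n → LevelFace (vertexRowOf V m) (faceOf E m)
  levelFace-faceOf zero _ = subst (λ b → LevelFace (b ∷ []) []) (sym (isReached (0 , 0) z≤n)) base
  levelFace-faceOf (suc m) m< = step (targets-rowOf m m<)
    (trans (length-rowOf E m) (cong suc (sym (length-faceOf E m))))
    (subst (λ S → LevelFace S (faceOf E m)) (sym (sources-rowOf m m<)) (levelFace-faceOf m (<⇒≤ m<)))

  vertexRowOf-top : length top ≡ suc n → vertexRowOf V n ≡ top
  vertexRowOf-top len = applyUpTo-nth false _ (suc n) top len λ i i< → onTop (i , n ∸ i) (m+[n∸m]≡n (s≤s⁻¹ i<))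

  faceE-faceOf : ∀ e → faceE (faceOf E n) e ≡ E e
  faceE-faceOf ((i , j) , s) with <-≤-connex (i + j) n
  ... | inj₁ v< = trans (below s) (cong (λ x → E ((i , x) , s)) (m+n∸m≡n i j))
    where
    bits≡ : bitsAt (row (faceOf E n) (i + j)) i ≡ (E ((i , i + j ∸ i) , U) , E ((i , i + j ∸ i) , R))
    bits≡ = trans (cong (λ e → bitsAt e i) (row-faceOf E n v<)) (bitsAt-rowOf E (i + j) (m≤m+n i j))
    below : ∀ s → faceE (faceOf E n) ((i , j) , s) ≡ E ((i , i + j ∸ i) , s)
    below U = cong proj₁ bits≡
    below R = cong proj₂ bits≡
  ... | inj₂ n≤ = bool-ext
    (λ eq → ⊥-elim (<⇒≱ (subst (i + j <_) (length-faceOf E n)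
       (IsFace.edgeBounded (isFace-levelFace (levelFace-faceOf n ≤-refl)) (i , j) s eq)) n≤))
    (λ eq → ⊥-elim (<⇒≱ (edgeBounded (i , j) s eq) n≤))

reached-cong : ∀ {E E′} → (∀ e → E e ≡ E′ e) → ∀ v → reached E v ≡ reached E′ v
reached-cong eq (zero , zero) = refl
reached-cong eq (zero , suc j) = eq _
reached-cong eq (suc i , zero) = eq _
reached-cong eq (suc i , suc j) = cong₂ _∨_ (eq _) (eq _)

-- Up to degree n, `isReached` computes the vertices from the edges, and beyond it `bounded`
-- excludes them. Identifying two faces thus reduces to comparing edges.
vertices-determined : ∀ {n top V E top′ V′ E′} → IsFace n top V E → IsFace n top′ V′ E′ →
  (∀ e → E e ≡ E′ e) → ∀ v → V v ≡ V′ v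
vertices-determined {V = V} {V′ = V′} F F′ eq v = bool-ext
  (λ p → trans (sym (same (IsFace.bounded F v p))) p) (λ p → trans (same (IsFace.bounded F′ v p)) p)
  where
  same : deg v ≤ _ → V v ≡ V′ v
  same v≤ = trans (IsFace.isReached F v v≤) (trans (reached-cong eq v) (sym (IsFace.isReached F′ v v≤)))

faceOf-cong : ∀ {E E′} n → (∀ v s → deg v < n → E (v , s) ≡ E′ (v , s)) → faceOf E n ≡ faceOf E′ n
faceOf-cong zero eq = refl
faceOf-cong (suc n) eq = cong₂ _∷_
  (applyUpTo-cong (suc n) λ i i< → let d< = ≤-reflexive (cong suc (m+[n∸m]≡n (s≤s⁻¹ i<))) in
    cong₂ _,_ (eq (i , n ∸ i) U d<) (eq (i , n ∸ i) R d<))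
  (faceOf-cong n λ v s v< → eq v s (m<n⇒m<1+n v<))

faceOf-faceE : ∀ {top γ} → LevelFace top γ → faceOf (faceE γ) (length γ) ≡ γ
faceOf-faceE base = refl
faceOf-faceE (step {e = e} {γ} _ len F) = cong₂ _∷_
  (applyUpTo-nth (false , false) _ (suc (length γ)) e len λ i i< →
     cong (λ e′ → bitsAt e′ i) (trans (cong (row (e ∷ γ)) (m+[n∸m]≡n (s≤s⁻¹ i<))) (row-top e γ)))
  (trans (faceOf-cong (length γ) lower) (faceOf-faceE F))
  where
  lower : ∀ v s → deg v < length γ → faceE (e ∷ γ) (v , s) ≡ faceE γ (v , s)
  lower (i , j) U v< = cong (λ e′ → proj₁ (bitsAt e′ i)) (row-below e γ v<)
  lower (i , j) R v< = cong (λ e′ → proj₂ (bitsAt e′ i)) (row-below e γ v<)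

-- The dimension of a face

sumTo : ℕ → (ℕ → ℕ) → ℕ
sumTo zero f = 0
sumTo (suc n) f = f 0 + sumTo n (f ∘ suc)

sumTo-cong : ∀ n {f g} → (∀ i → i < n → f i ≡ g i) → sumTo n f ≡ sumTo n g
sumTo-cong zero eq = refl
sumTo-cong (suc n) eq = cong₂ _+_ (eq 0 (s≤s z≤n)) (sumTo-cong n (λ i i< → eq (suc i) (s≤s i<)))

sumTo-last : ∀ n f → sumTo (suc n) f ≡ sumTo n f + f n
sumTo-last zero f = +-identityʳ (f 0)
sumTo-last (suc n) f = trans (cong (f 0 +_) (sumTo-last n (f ∘ suc))) (sym (+-assoc (f 0) _ _))

sumTo-+ : ∀ n f g → sumTo n (λ i → f i + g i) ≡ sumTo n f + sumTo n g
sumTo-+ zero f g = refl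
sumTo-+ (suc n) f g = trans (cong (f 0 + g 0 +_) (sumTo-+ n (f ∘ suc) (g ∘ suc))) (interchange +-commutativeSemigroup (f 0) (g 0) _ _)

-- The candidates fill a square, the levels only the triangle below the top. Peeling the row of
-- first coordinate 0 leaves a smaller square, since the last entry of each other row vanishes.
sumTo-diagonals : ∀ n (f : ℕ → ℕ → ℕ) → (∀ i j → n ≤ i + j → f i j ≡ 0) →
  sumTo n (λ i → sumTo n (f i)) ≡ sumTo n (λ m → sumTo (suc m) (λ i → f i (m ∸ i)))
sumTo-diagonals zero f f≡0 = refl
sumTo-diagonals (suc n) f f≡0 = begin
  sumTo (suc n) (f 0) + sumTo n (λ i → sumTo (suc n) (f (suc i)))
    ≡⟨ cong (sumTo (suc n) (f 0) +_) (sumTo-cong n (λ i _ →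
         trans (sumTo-last n (f (suc i))) (trans (cong (sumTo n (f (suc i)) +_) (f≡0 (suc i) n (s≤s (m≤n+m n i)))) (+-identityʳ _)))) ⟩
  sumTo (suc n) (f 0) + sumTo n (λ i → sumTo n (f (suc i)))
    ≡⟨ cong (sumTo (suc n) (f 0) +_) (sumTo-diagonals n (f ∘ suc) (λ i j n≤ → f≡0 (suc i) j (s≤s n≤))) ⟩
  -- The inner sum for m = 0 is empty, so this shift of m by one holds by computation.
  sumTo (suc n) (f 0) + sumTo (suc n) (λ m → sumTo m (λ i → f (suc i) (m ∸ suc i)))
    ≡⟨ sym (sumTo-+ (suc n) (f 0) (λ m → sumTo m (λ i → f (suc i) (m ∸ suc i)))) ⟩
  sumTo (suc n) (λ m → sumTo (suc m) (λ i → f i (m ∸ i))) ∎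
  where open ≡-Reasoning

sumOver : {A : Set} → (A → ℕ) → List A → ℕ
sumOver f xs = sum (map f xs)

sumOver-++ : {A : Set} (f : A → ℕ) → ∀ xs ys → sumOver f (xs ++ ys) ≡ sumOver f xs + sumOver f ys
sumOver-++ f [] ys = refl
sumOver-++ f (x ∷ xs) ys = trans (cong (f x +_) (sumOver-++ f xs ys)) (sym (+-assoc (f x) _ _))

sumOver-row : (f : ℕ × ℕ → ℕ) → ∀ x (h : ℕ → ℕ) n →
  sumOver f (map (x ,_) (applyUpTo h n)) ≡ sumTo n (λ j → f (x , h j))
sumOver-row f x h zero = refl
sumOver-row f x h (suc n) = cong (f (x , h 0) +_) (sumOver-row f x (h ∘ suc) n)

sumOver-grid : ∀ (f : ℕ × ℕ → ℕ) (g : ℕ → ℕ) m n →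
  sumOver f (cartesianProduct (applyUpTo g m) (upTo n)) ≡ sumTo m (λ i → sumTo n (λ j → f (g i , j)))
sumOver-grid f g zero n = refl
sumOver-grid f g (suc m) n = trans (sumOver-++ f (map (g 0 ,_) (upTo n)) _)
  (cong₂ _+_ (sumOver-row f (g 0) id n) (sumOver-grid f (g ∘ suc) m n))

countTrue-∷ : ∀ b bs → countTrue (b ∷ bs) ≡ b2n b + countTrue bs
countTrue-∷ true bs = refl
countTrue-∷ false bs = refl

countTrue-map : {A : Set} (V : A → Bool) → ∀ vs → countTrue (map V vs) ≡ sumOver (b2n ∘ V) vs
countTrue-map V [] = refl
countTrue-map V (v ∷ vs) = trans (countTrue-∷ (V v) _) (cong (b2n (V v) +_) (countTrue-map V vs))

outdegree : (Edge → Bool) → Vertex → ℕ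
outdegree E v = b2n (E (v , U)) + b2n (E (v , R))

countTrue-edges : ∀ E vs → countTrue (map E (cartesianProduct vs (R ∷ U ∷ []))) ≡ sumOver (outdegree E) vs
countTrue-edges E [] = refl
countTrue-edges E (v ∷ vs) = begin
  countTrue (E (v , R) ∷ E (v , U) ∷ rest) ≡⟨ countTrue-∷ (E (v , R)) _ ⟩
  r + countTrue (E (v , U) ∷ rest) ≡⟨ cong (r +_) (countTrue-∷ (E (v , U)) rest) ⟩
  r + (u + countTrue rest) ≡⟨ sym (+-assoc r u _) ⟩
  r + u + countTrue rest ≡⟨ cong₂ _+_ (+-comm r u) (countTrue-edges E vs) ⟩
  u + r + sumOver (outdegree E) vs ∎
  where
  open ≡-Reasoning
  rest = map E (cartesianProduct vs (R ∷ U ∷ []))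
  r = b2n (E (v , R))
  u = b2n (E (v , U))

levelEdges : Level → ℕ
levelEdges = sumOver (λ (u , r) → b2n u + b2n r)

levelVertices : List Bool → ℕ
levelVertices = sumOver b2n

sumTo-nth : {A : Set} (x : A) (f : A → ℕ) → ∀ xs → sumTo (length xs) (λ i → f (nth x xs i)) ≡ sumOver f xs
sumTo-nth x f [] = refl
sumTo-nth x f (y ∷ ys) = cong (f y +_) (sumTo-nth x f ys)

b2n-∨-∧ : ∀ r u → b2n r + b2n u ≡ b2n (r ∨ u) + b2n (r ∧ u)
b2n-∨-∧ true true = refl
b2n-∨-∧ true false = refl
b2n-∨-∧ false true = refl
b2n-∨-∧ false false = refl

-- Inclusion-exclusion at each target, with edges regrouped by target instead of source.
levelEdges-excess : ∀ r e → b2n r + levelEdges e ≡ levelVertices (targetsFrom r e) + excessFrom r e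
levelEdges-excess r [] = sym (+-identityʳ _)
levelEdges-excess r ((u , r′) ∷ e) = begin
  b2n r + (b2n u + b2n r′ + levelEdges e) ≡⟨ cong (b2n r +_) (+-assoc (b2n u) _ _) ⟩
  b2n r + (b2n u + (b2n r′ + levelEdges e)) ≡⟨ sym (+-assoc (b2n r) _ _) ⟩
  b2n r + b2n u + (b2n r′ + levelEdges e) ≡⟨ cong₂ _+_ (b2n-∨-∧ r u) (levelEdges-excess r′ e) ⟩
  b2n (r ∨ u) + b2n (r ∧ u) + (levelVertices (targetsFrom r′ e) + excessFrom r′ e)
    ≡⟨ interchange +-commutativeSemigroup (b2n (r ∨ u)) _ _ _ ⟩
  b2n (r ∨ u) + levelVertices (targetsFrom r′ e) + (b2n (r ∧ u) + excessFrom r′ e) ∎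
  where open ≡-Reasoning

edgeTotal : Face → ℕ
edgeTotal γ = sumTo (length γ) (levelEdges ∘ row γ)

vertexTotal : List Bool → Face → ℕ
vertexTotal top γ = sumTo (suc (length γ)) (levelVertices ∘ vertexRow top γ)

-- Every vertex but the origin is a target of exactly one level; the origin gives the 1. In this
-- additive form the truncated subtraction in `dim` is seen to be exact.
eulerFormula : ∀ {top γ} → LevelFace top γ → edgeTotal γ + 1 ≡ faceExcess γ + vertexTotal top γ
eulerFormula base = refl
eulerFormula (step {top} {e} {γ} eq len F) = begin
  edgeTotal (e ∷ γ) + 1 ≡⟨ cong (_+ 1) edges ⟩
  edgeTotal γ + levelEdges e + 1 ≡⟨ +-assoc (edgeTotal γ) _ _ ⟩
  edgeTotal γ + (levelEdges e + 1) ≡⟨ cong (edgeTotal γ +_) (+-comm (levelEdges e) 1) ⟩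
  edgeTotal γ + (1 + levelEdges e) ≡⟨ sym (+-assoc (edgeTotal γ) 1 _) ⟩
  edgeTotal γ + 1 + levelEdges e ≡⟨ cong₂ _+_ (eulerFormula F) (levelEdges-excess false e) ⟩
  faceExcess γ + vertexTotal (sources e) γ + (levelVertices (targets e) + excess e)
    ≡⟨ cong (faceExcess γ + vertexTotal (sources e) γ +_) (+-comm (levelVertices (targets e)) _) ⟩
  faceExcess γ + vertexTotal (sources e) γ + (excess e + levelVertices (targets e))
    ≡⟨ interchange +-commutativeSemigroup (faceExcess γ) _ _ _ ⟩
  faceExcess γ + excess e + (vertexTotal (sources e) γ + levelVertices (targets e))
    ≡⟨ cong₂ _+_ (+-comm (faceExcess γ) _) (sym vertices) ⟩
  excess e + faceExcess γ + vertexTotal top (e ∷ γ) ∎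
  where
  open ≡-Reasoning
  n = length γ
  edges : edgeTotal (e ∷ γ) ≡ edgeTotal γ + levelEdges e
  edges = trans (sumTo-last n (levelEdges ∘ row (e ∷ γ)))
    (cong₂ _+_ (sumTo-cong n λ i i< → cong levelEdges (row-below e γ i<)) (cong levelEdges (row-top e γ)))
  vertices : vertexTotal top (e ∷ γ) ≡ vertexTotal (sources e) γ + levelVertices (targets e)
  vertices = trans (sumTo-last (suc n) (levelVertices ∘ vertexRow top (e ∷ γ)))
    (cong₂ _+_ (sumTo-cong (suc n) λ i i< → cong levelVertices (vertexRow-∷ top e γ (s≤s⁻¹ i<)))
      (cong levelVertices (trans (vertexRow-top top (e ∷ γ)) (sym eq))))

length-vertexRow : ∀ {top γ} → LevelFace top γ → ∀ {m} → m ≤ length γ → length (vertexRow top γ m) ≡ suc m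
length-vertexRow {top} {γ} F {m} m≤ with m≤n⇒m<n∨m≡n m≤
... | inj₁ m< = trans (cong length (vertexRow-≢ top γ (<⇒≢ m<))) (trans (length-map _ (row γ m)) (length-row F m<))
... | inj₂ refl = trans (cong length (vertexRow-top top γ)) (length-top F)

-- Stacks of levels as encoded subgraphs

encode : List ℕ → Face → Subgraph
encode k γ = map (faceV (bits k) γ) (candVerts k) , map (faceE γ) (candEdges k)

module _ k {γ} (F : LevelFace (bits k) γ) (len : length γ ≡ total k) where

  private
    n = total k
    V = faceV (bits k) γ
    E = faceE γ
    G = isFace-levelFace F

  countTrue-encode-vertices : countTrue (map V (candVerts k)) ≡ vertexTotal (bits k) γ
  countTrue-encode-vertices = begin
    countTrue (map V (candVerts k)) ≡⟨ countTrue-map V (candVerts k) ⟩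
    sumOver (b2n ∘ V) (candVerts k) ≡⟨ sumOver-grid (b2n ∘ V) id (suc n) (suc n) ⟩
    sumTo (suc n) (λ i → sumTo (suc n) (λ j → b2n (V (i , j))))
      ≡⟨ sumTo-diagonals (suc n) (λ i j → b2n (V (i , j))) above ⟩
    sumTo (suc n) (λ m → sumTo (suc m) (λ i → b2n (V (i , m ∸ i))))
      ≡⟨ sumTo-cong (suc n) diagonal ⟩
    sumTo (suc n) (levelVertices ∘ vertexRow (bits k) γ)
      ≡⟨ cong (λ m → sumTo (suc m) (levelVertices ∘ vertexRow (bits k) γ)) (sym len) ⟩
    vertexTotal (bits k) γ ∎
    where
    open ≡-Reasoning
    above : ∀ i j → suc n ≤ i + j → b2n (V (i , j)) ≡ 0
    above i j n< = cong b2n (¬-not λ eq → <⇒≱ n< (subst (i + j ≤_) len (IsFace.bounded G (i , j) eq)))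
    diagonal : ∀ m → m < suc n → sumTo (suc m) (λ i → b2n (V (i , m ∸ i))) ≡ levelVertices (vertexRow (bits k) γ m)
    diagonal m m< = begin
      sumTo (suc m) (λ i → b2n (V (i , m ∸ i)))
        ≡⟨ sumTo-cong (suc m) (λ i i< → cong (λ x → b2n (nth false (vertexRow (bits k) γ x) i)) (m+[n∸m]≡n (s≤s⁻¹ i<))) ⟩
      sumTo (suc m) (λ i → b2n (nth false (vertexRow (bits k) γ m) i))
        ≡⟨ cong (λ x → sumTo x (λ i → b2n (nth false (vertexRow (bits k) γ m) i)))
             (sym (length-vertexRow F (subst (m ≤_) (sym len) (s≤s⁻¹ m<)))) ⟩
      sumTo (length (vertexRow (bits k) γ m)) (λ i → b2n (nth false (vertexRow (bits k) γ m) i))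
        ≡⟨ sumTo-nth false b2n (vertexRow (bits k) γ m) ⟩
      levelVertices (vertexRow (bits k) γ m) ∎

  countTrue-encode-edges : countTrue (map E (candEdges k)) ≡ edgeTotal γ
  countTrue-encode-edges = begin
    countTrue (map E (candEdges k)) ≡⟨ countTrue-edges E (candVerts k) ⟩
    sumOver (outdegree E) (candVerts k) ≡⟨ sumOver-grid (outdegree E) id (suc n) (suc n) ⟩
    sumTo (suc n) (λ i → sumTo (suc n) (λ j → outdegree E (i , j)))
      ≡⟨ sumTo-diagonals (suc n) (λ i j → outdegree E (i , j)) (λ i j n< → above i j (<⇒≤ n<)) ⟩
    sumTo (suc n) (λ m → sumTo (suc m) (λ i → outdegree E (i , m ∸ i))) ≡⟨ sumTo-last n _ ⟩
    -- The candidates also include sources on the top antidiagonal, which no edge leaves, so the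
    -- last summand vanishes.
    sumTo n (λ m → sumTo (suc m) (λ i → outdegree E (i , m ∸ i))) + sumTo (suc n) (λ i → outdegree E (i , n ∸ i))
      ≡⟨ cong₂ _+_ (sumTo-cong n diagonal)
           (trans (sumTo-cong (suc n) (λ i i< → above i (n ∸ i) (≤-reflexive (sym (m+[n∸m]≡n (s≤s⁻¹ i<)))))) (sumTo-zero (suc n))) ⟩
    sumTo n (levelEdges ∘ row γ) + 0 ≡⟨ +-identityʳ _ ⟩
    sumTo n (levelEdges ∘ row γ) ≡⟨ cong (λ m → sumTo m (levelEdges ∘ row γ)) (sym len) ⟩
    edgeTotal γ ∎
    where
    open ≡-Reasoning
    sumTo-zero : ∀ m → sumTo m (λ _ → 0) ≡ 0
    sumTo-zero zero = refl
    sumTo-zero (suc m) = sumTo-zero m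
    noEdge : ∀ i j s → n ≤ i + j → b2n (E ((i , j) , s)) ≡ 0
    noEdge i j s n≤ = cong b2n (¬-not λ eq → <⇒≱ (subst (i + j <_) len (IsFace.edgeBounded G (i , j) s eq)) n≤)
    above : ∀ i j → n ≤ i + j → outdegree E (i , j) ≡ 0
    above i j n≤ = cong₂ _+_ (noEdge i j U n≤) (noEdge i j R n≤)
    degreeAt : Bool × Bool → ℕ
    degreeAt (u , r) = b2n u + b2n r
    diagonal : ∀ m → m < n → sumTo (suc m) (λ i → outdegree E (i , m ∸ i)) ≡ levelEdges (row γ m)
    diagonal m m< = begin
      sumTo (suc m) (λ i → outdegree E (i , m ∸ i))
        ≡⟨ sumTo-cong (suc m) (λ i i< → cong (λ x → degreeAt (bitsAt (row γ x) i)) (m+[n∸m]≡n (s≤s⁻¹ i<))) ⟩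
      sumTo (suc m) (λ i → degreeAt (bitsAt (row γ m) i))
        ≡⟨ cong (λ x → sumTo x (λ i → degreeAt (bitsAt (row γ m) i))) (sym (length-row F (subst (m <_) (sym len) m<))) ⟩
      sumTo (length (row γ m)) (λ i → degreeAt (bitsAt (row γ m) i))
        ≡⟨ sumTo-nth (false , false) degreeAt (row γ m) ⟩
      levelEdges (row γ m) ∎

  dim-encode : dim (encode k γ) ≡ faceExcess γ
  dim-encode = begin
    countTrue (map E (candEdges k)) + 1 ∸ countTrue (map V (candVerts k))
      ≡⟨ cong₂ (λ x y → x + 1 ∸ y) countTrue-encode-edges countTrue-encode-vertices ⟩
    edgeTotal γ + 1 ∸ vertexTotal (bits k) γ ≡⟨ cong (_∸ vertexTotal (bits k) γ) (eulerFormula F) ⟩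
    faceExcess γ + vertexTotal (bits k) γ ∸ vertexTotal (bits k) γ ≡⟨ m+n∸n≡m (faceExcess γ) (vertexTotal (bits k) γ) ⟩
    faceExcess γ ∎
    where open ≡-Reasoning

  encode-∈-faces : encode k γ ∈ map (unionOf k) (filterᵇ (coversTerminals k) (sublists (positivePaths k)))
  encode-∈-faces = subst (_∈ map (unionOf k) (filterᵇ (coversTerminals k) (sublists (positivePaths k))))
    (cong₂ _,_ (map-cong (onPath-facePaths k G′) (candVerts k)) (map-cong (alongPath-facePaths k G′) (candEdges k)))
    (∈-map⁺ (unionOf k) (filterᵇ⁺ (coversTerminals k)
      (filterᵇ-sublist (λ p → all E (edgesFrom origin p)) (positivePaths k)) (facePaths-cover k G′)))
    where
    G′ : IsFace (total k) (bits k) V E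
    G′ = subst (λ m → IsFace m (bits k) V E) len G

union-∈-encode : ∀ k {g} → g ∈ map (unionOf k) (filterᵇ (coversTerminals k) (sublists (positivePaths k))) →
  g ∈ map (encode k) (levelFaces (total k) (bits k))
union-∈-encode k g∈ with ∈-map⁻ (unionOf k) g∈
... | P , P∈ , refl with filterᵇ⁻ (coversTerminals k) {xs = sublists (positivePaths k)} P∈
... | P∈′ , covers = subst (_∈ map (encode k) (levelFaces n (bits k))) encode≡
    (∈-map⁺ (encode k) (subst (λ m → γ ∈ levelFaces m (bits k)) len (levelFaces⁺ F)))
  where
  n = total k
  G : IsFace n (bits k) (onPath P) (alongPath P)
  G = isFace-union k P (λ p p∈ → sublist-⊆ (positivePaths k) P∈′ p∈) covers
  γ = faceOf (alongPath P) n
  len : length γ ≡ n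
  len = length-faceOf (alongPath P) n
  F : LevelFace (bits k) γ
  F = subst (λ S → LevelFace S γ) (vertexRowOf-top G (length-bits k)) (levelFace-faceOf G n ≤-refl)
  encode≡ : encode k γ ≡ unionOf k P
  encode≡ = cong₂ _,_
    (map-cong (vertices-determined (subst (λ m → IsFace m (bits k) (faceV (bits k) γ) (faceE γ)) len (isFace-levelFace F))
      G (faceE-faceOf G)) (candVerts k))
    (map-cong (faceE-faceOf G) (candEdges k))

-- Counting the faces

map-≡⇒≡ : {A B : Set} {f g : A → B} → ∀ {xs x} → map f xs ≡ map g xs → x ∈ xs → f x ≡ g x
map-≡⇒≡ eq (here refl) = ∷-injectiveˡ eq
map-≡⇒≡ eq (there x∈) = map-≡⇒≡ (∷-injectiveʳ eq) x∈

-- The levels are rebuilt from the edges below the top, all of which occur among the candidates.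
-- Membership supplies the number and the lengths of the levels used in rebuilding them.
encode-injective : ∀ k {γ γ′} → γ ∈ levelFaces (total k) (bits k) → γ′ ∈ levelFaces (total k) (bits k) →
  encode k γ ≡ encode k γ′ → γ ≡ γ′
encode-injective k {γ} {γ′} γ∈ γ′∈ eq with levelFaces⁻ (total k) (bits k) γ∈ | levelFaces⁻ (total k) (bits k) γ′∈
... | F , len | F′ , len′ = begin
  γ ≡⟨ sym (faceOf-faceE F) ⟩
  faceOf (faceE γ) (length γ) ≡⟨ cong (faceOf (faceE γ)) len ⟩
  faceOf (faceE γ) (total k) ≡⟨ faceOf-cong (total k) (λ v s v< → map-≡⇒≡ (cong proj₂ eq) (candidate v s v<)) ⟩
  faceOf (faceE γ′) (total k) ≡⟨ cong (faceOf (faceE γ′)) (sym len′) ⟩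
  faceOf (faceE γ′) (length γ′) ≡⟨ faceOf-faceE F′ ⟩
  γ′ ∎
  where
  open ≡-Reasoning
  steps : ∀ s → s ∈ R ∷ U ∷ []
  steps R = here refl
  steps U = there (here refl)
  candidate : ∀ v s → deg v < total k → (v , s) ∈ candEdges k
  candidate (i , j) s v< = ∈-cartesianProduct⁺
    (∈-cartesianProduct⁺ (∈-upTo⁺ (m≤n⇒m≤1+n (≤-<-trans (m≤m+n i j) v<))) (∈-upTo⁺ (m≤n⇒m≤1+n (≤-<-trans (m≤n+m j i) v<))))
    (steps s)

map-unique : {A B : Set} (f : A → B) → ∀ {xs} → (∀ {x y} → x ∈ xs → y ∈ xs → f x ≡ f y → x ≡ y) →
  Unique xs → Unique (map f xs)
map-unique f inj [] = []
map-unique f {x ∷ xs} inj (x∉ ∷ u) =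
  All.tabulate (λ y∈ eq → let z , z∈ , p = ∈-map⁻ f y∈ in All.lookup x∉ z∈ (inj (here refl) (there z∈) (trans eq p)))
  ∷ map-unique f (λ p q → inj (there p) (there q)) u

eqBs-sound : ∀ xs ys → eqBs xs ys ≡ true → xs ≡ ys
eqBs-sound [] [] eq = refl
eqBs-sound (true ∷ xs) (true ∷ ys) eq = cong (true ∷_) (eqBs-sound xs ys eq)
eqBs-sound (false ∷ xs) (false ∷ ys) eq = cong (false ∷_) (eqBs-sound xs ys eq)

eqBs-refl : ∀ xs → eqBs xs xs ≡ true
eqBs-refl [] = refl
eqBs-refl (true ∷ xs) = eqBs-refl xs
eqBs-refl (false ∷ xs) = eqBs-refl xs

module _ {A : Set} (eq : A → A → Bool) (eq-sound : ∀ x y → eq x y ≡ true → x ≡ y) (eq-refl : ∀ x → eq x x ≡ true) where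

  deduplicateᵇ-unique : ∀ xs → Unique (deduplicateᵇ eq xs)
  deduplicateᵇ-unique [] = []
  deduplicateᵇ-unique (x ∷ xs) =
    All.map (λ { ¬eq refl → ¬eq (Equivalence.from T-≡ (eq-refl x)) }) (all-filter (λ y → ¬? (T? (eq x y))) (deduplicateᵇ eq xs))
    ∷ filter⁺ (λ y → ¬? (T? (eq x y))) (deduplicateᵇ-unique xs)

  deduplicateᵇ⁺ : ∀ {xs x} → x ∈ xs → x ∈ deduplicateᵇ eq xs
  deduplicateᵇ⁺ (here refl) = here refl
  deduplicateᵇ⁺ {y ∷ xs} {x} (there x∈) with eq y x in p
  ... | true = here (sym (eq-sound y x p))
  ... | false = there (∈-filter⁺ (λ z → ¬? (T? (eq y z))) (deduplicateᵇ⁺ x∈) (subst T p))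

  deduplicateᵇ⁻ : ∀ xs {x} → x ∈ deduplicateᵇ eq xs → x ∈ xs
  deduplicateᵇ⁻ (y ∷ xs) (here refl) = here refl
  deduplicateᵇ⁻ (y ∷ xs) (there x∈) =
    there (deduplicateᵇ⁻ xs (proj₁ (∈-filter⁻ (λ z → ¬? (T? (eq y z))) {xs = deduplicateᵇ eq xs} x∈)))

eqSub-sound : ∀ g h → eqSub g h ≡ true → g ≡ h
eqSub-sound (a , b) (c , d) eq with ∧-true (eqBs a c) eq
... | p , q = cong₂ _,_ (eqBs-sound a c p) (eqBs-sound b d q)

eqSub-refl : ∀ g → eqSub g g ≡ true
eqSub-refl (a , b) = cong₂ _∧_ (eqBs-refl a) (eqBs-refl b)

count-cong : {A : Set} {w w′ : A → ℕ} → ∀ xs d → (∀ {x} → x ∈ xs → w x ≡ w′ x) → count w xs d ≡ count w′ xs d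
count-cong [] d eq = refl
count-cong {w = w} {w′} (x ∷ xs) d eq with w x ≡ᵇ d | w′ x ≡ᵇ d | cong (_≡ᵇ d) (eq (here refl))
... | true | true | _ = cong suc (count-cong xs d (eq ∘ there))
... | false | false | _ = count-cong xs d (eq ∘ there)

-- Two lists without repetitions and with the same members are permutations of each other, so the
-- order in which `faces` lists the unions is irrelevant to the count.
fcoeff-faceCount : ∀ k d → fcoeff k d ≡ faceCount′ (bits k) d
fcoeff-faceCount k d = begin
  count dim (faces k) d ≡⟨ ↭-length (filter-↭ (λ g → T? (dim g ≡ᵇ d)) (∼bag⇒↭ (unique∧set⇒bag uniqueˡ uniqueʳ sameFaces))) ⟩
  count dim (map (encode k) canonical) d ≡⟨ count-map dim (encode k) canonical d ⟩
  count (dim ∘ encode k) canonical d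
    ≡⟨ count-cong {w = dim ∘ encode k} {faceExcess} canonical d (λ γ∈ → uncurry (dim-encode k) (levelFaces⁻ (total k) (bits k) γ∈)) ⟩
  count faceExcess canonical d ≡⟨ count-levelFaces (total k) (bits k) d ⟩
  faceCount (total k) (bits k) d ≡⟨ cong (λ m → faceCount (m ∸ 1) (bits k) d) (sym (length-bits k)) ⟩
  faceCount′ (bits k) d ∎
  where
  open ≡-Reasoning
  canonical = levelFaces (total k) (bits k)
  unions = map (unionOf k) (filterᵇ (coversTerminals k) (sublists (positivePaths k)))
  uniqueˡ = deduplicateᵇ-unique eqSub eqSub-sound eqSub-refl
    unions
  uniqueʳ = map-unique (encode k) (encode-injective k) (levelFaces-unique (total k) (bits k))
  sameFaces : ∀ {g} → g ∈ faces k ⇔ g ∈ map (encode k) canonical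
  sameFaces = mk⇔
    (λ g∈ → union-∈-encode k (deduplicateᵇ⁻ eqSub eqSub-sound eqSub-refl unions g∈))
    (λ g∈ → let γ , γ∈ , eq = ∈-map⁻ (encode k) {xs = canonical} g∈ in
      deduplicateᵇ⁺ eqSub eqSub-sound eqSub-refl
        (subst (_∈ unions) (sym eq)
          (uncurry (encode-∈-faces k) (levelFaces⁻ (total k) (bits k) γ∈))))

-- A row with a single vertex is the origin's, below which there is no level to remove.
faceCount-recursion : ∀ t ts d → ¬ ts ≡ [] → faceCount′ (t ∷ ts) d ≡ levelSum t ts faceCount′ d
faceCount-recursion t [] d ts≢[] = ⊥-elim (ts≢[] refl)
faceCount-recursion t ts@(_ ∷ ts′) d _ =
  levelSum-cong t ts (λ S d′ len → cong (λ m → faceCount (m ∸ 1) S d′) (sym len)) d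

theorem1p12 : (r : ℕ) (a : Vec ℕ (suc r)) (d : ℕ) → atY0 (𝒟 r (ΨΨ r)) a d ≡ 0ℤ
theorem1p12 r a d = begin
  ∂xAll r (ΨΨ r) a z d -ℤ compose (map Lop (allFin r)) (ΨΨ r) a z d
    ≡⟨ cong₂ _-ℤ_ derivative
         (Lops-coeff r (ΨΨ r) faceCount′ (λ a′ b d′ → cong pos (fcoeff-faceCount (interleave a′ b) d′)) a d) ⟩
  S -ℤ S ≡⟨ +-inverseʳ S ⟩
  0ℤ ∎
  where
  open ≡-Reasoning
  z = Vec.replicate r 0
  S = pos (levelSum true (tailBits a) faceCount′ d)
  nonempty : ¬ tailBits a ≡ []
  nonempty eq with tailBits-∷ a
  ... | _ , _ , eq′ with trans (sym eq) eq′
  ... | ()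
  derivative : ∂xAll r (ΨΨ r) a z d ≡ S
  derivative = trans (∂xAll-coeff r (ΨΨ r) a z d) (cong pos (trans (fcoeff-faceCount (interleave (Vec.map suc a) z) d)
    (trans (cong (λ ts → faceCount′ ts d) (bits-suc a)) (faceCount-recursion true (tailBits a) d nonempty))))
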